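{- Let $(X,d)$ be a perfect computable metric space with special points $\{q_i\}_{i\in\omega}$, and let $\mathcal{C}\subseteq X$ be $\Pi^0_1(\emptyset')$ with respect to $(X,d)$. Then there is a c.e. set $D\subseteq\{q_i\}_{i\in\omega}$ of special points such that $\mathcal{C}$ is exactly the set of limit points of $D$ in $(X,d)$.
   Context: A computable metric space is a metric space $(X,d)$ with a dense sequence $\{q_i\}$ of special points such that $d(q_i,q_j)$ is a computable real uniformly in $i,j$. It is perfect if it has no isolated points. Basic open balls are $B(q_i,2^{ -j})$, enumerated computably. $\mathcal{C}\subseteq X$ is $\Pi^0_1(\emptyset')$ if there is a $\Sigma^0_2$ set $I\subseteq\omega$ of indices of basic open balls with $X\setminus\mathcal{C}=\bigcup_{k\in I}B_k$. A set $D$ of special points is c.e. if the set of their indices is c.e. A point $x$ is a limit point of $D$ if every open ball around $x$ contains a point of $D$ different from $x$. -}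

module Defs where

open import Data.Bool.Base using (if_then_else_)
open import Data.Fin.Base as Fin using (Fin)
open import Data.Integer.Base as ℤ using (_⊖_; +_)
open import Data.Nat.Base as ℕ using (ℕ; zero; suc)
import Data.Nat.Properties as ℕₚ
open import Data.Product.Base using (Σ; ∃; ∃-syntax; _×_; _,_; proj₁; proj₂)
open import Data.Rational.Base as ℚ using (ℚ; 0ℚ; 1ℚ; ½; _/_)
import Data.Rational.Properties as ℚₚ
import Data.Rational.Unnormalised.Base as ℚᵘ
import Data.Rational.Unnormalised.Properties as ℚᵘₚ
open import Data.Rational.Solver using (module +-*-Solver)
open import Data.Vec.Base using (Vec; []; _∷_; lookup)
open import Data.Vec.Relation.Binary.Pointwise.Inductive using (Pointwise)
open import Function.Bundles using (_⇔_)
open import Function.Metric.Structures using (IsGeneralMetric)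
open import Level using (Level; 0ℓ; _⊔_) renaming (suc to lsuc)
open import Relation.Binary.Core using (Rel)
open import Relation.Binary.Structures using (IsEquivalence; IsPartialOrder)
open import Relation.Binary.PropositionalEquality
  using (_≡_; refl; sym; trans; cong; cong₂; subst; subst₂)
open import Relation.Nullary using (¬_; yes; no; does; contradiction)
open import Relation.Unary using (Pred; Decidable; _∈_; _∉_)

------------------------------------------------------------------------
-- Computability: Kleene's partial recursive functions

data Code : ℕ → Set where
  zeroᶜ : ∀ {n} → Code n
  sucᶜ  : Code 1
  proj  : ∀ {n} → Fin n → Code n
  comp  : ∀ {m n} → Code m → Vec (Code n) m → Code n
  prec  : ∀ {n} → Code n → Code (2 ℕ.+ n) → Code (1 ℕ.+ n)
  min   : ∀ {n} → Code (1 ℕ.+ n) → Code n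

infix 4 _[_]⇓_

-- c [ xs ]⇓ y : the partial function coded by c is defined at xs, with value y.
data _[_]⇓_ : ∀ {n} → Code n → Vec ℕ n → ℕ → Set where
  ⇓zero : ∀ {n} {xs : Vec ℕ n} → zeroᶜ [ xs ]⇓ 0
  ⇓suc  : ∀ {x} → sucᶜ [ x ∷ [] ]⇓ suc x
  ⇓proj : ∀ {n} {i : Fin n} {xs} → proj i [ xs ]⇓ lookup xs i
  ⇓comp : ∀ {m n} {f : Code m} {gs : Vec (Code n) m} {xs ys z} →
          Pointwise (λ g y → g [ xs ]⇓ y) gs ys → f [ ys ]⇓ z →
          comp f gs [ xs ]⇓ z
  ⇓prec-zero : ∀ {n} {f : Code n} {g xs y} →
               f [ xs ]⇓ y → prec f g [ 0 ∷ xs ]⇓ y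
  ⇓prec-suc  : ∀ {n} {f : Code n} {g xs k y z} →
               prec f g [ k ∷ xs ]⇓ y → g [ k ∷ y ∷ xs ]⇓ z →
               prec f g [ suc k ∷ xs ]⇓ z
  ⇓min  : ∀ {n} {f : Code (1 ℕ.+ n)} {xs y} →
          f [ y ∷ xs ]⇓ 0 →
          (∀ z → z ℕ.< y → ∃[ w ] f [ z ∷ xs ]⇓ suc w) →
          min f [ xs ]⇓ y

Computable : ∀ {n} → (Vec ℕ n → ℕ) → Set
Computable {n} f = Σ (Code n) λ c → ∀ xs → c [ xs ]⇓ f xs

Computable₁ : (ℕ → ℕ) → Set
Computable₁ f = Σ (Code 1) λ c → ∀ x → c [ x ∷ [] ]⇓ f x

ComputablePred : ∀ {n} → Pred (Vec ℕ n) 0ℓ → Set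
ComputablePred P = Σ (Decidable P) λ P? → Computable λ xs → if does (P? xs) then 1 else 0

CE : Pred ℕ 0ℓ → Set
CE W = Σ (Code 1) λ c → ∀ x → x ∈ W ⇔ (∃[ y ] c [ x ∷ [] ]⇓ y)

Σ⁰₂ : Pred ℕ 0ℓ → Set₁
Σ⁰₂ I = Σ (Pred (Vec ℕ 3) 0ℓ) λ R → ComputablePred R ×
        (∀ k → k ∈ I ⇔ (∃[ s ] ∀ t → (k ∷ s ∷ t ∷ []) ∈ R))

Computableℚ : ∀ {n} → (Vec ℕ n → ℚ) → Set
Computableℚ {n} r =
  Σ (Vec ℕ n → ℕ) λ a → Σ (Vec ℕ n → ℕ) λ b → Σ (Vec ℕ n → ℕ) λ c →
  Computable a × Computable b × Computable c ×
  (∀ xs → r xs ≡ (a xs ⊖ b xs) / suc (c xs))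

------------------------------------------------------------------------
-- Real numbers, as regular Cauchy sequences of rationals (after Bishop, with
-- the modulus 2⁻ⁿ)

½^_ : ℕ → ℚ
½^ zero  = 1ℚ
½^ suc n = ½ ℚ.* ½^ n

infix 9 ½^_

record ℝ : Set where
  constructor mkℝ
  field
    seq     : ℕ → ℚ
    regular : ∀ m n → ℚ.∣ seq m ℚ.- seq n ∣ ℚ.≤ ½^ m ℚ.+ ½^ n

open ℝ public

infix  4 _<ᴿ_ _≤ᴿ_ _≈ᴿ_
infixl 6 _+ᴿ_

-- The n-th approximations of two reals are each off by at most 2⁻ⁿ, so a gap
-- larger than 2⁻ⁿ + 2⁻ⁿ between them witnesses a strict inequality.
data _<ᴿ_ (x y : ℝ) : Set where
  *<* : ∀ n → seq x n ℚ.+ (½^ n ℚ.+ ½^ n) ℚ.< seq y n → x <ᴿ y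

data _≤ᴿ_ (x y : ℝ) : Set where
  *≤* : (∀ n → seq x n ℚ.≤ seq y n ℚ.+ (½^ n ℚ.+ ½^ n)) → x ≤ᴿ y

_≈ᴿ_ : Rel ℝ 0ℓ
x ≈ᴿ y = x ≤ᴿ y × y ≤ᴿ x

½^-half : ∀ n → ½^ suc n ℚ.+ ½^ suc n ≡ ½^ n
½^-half n = trans (sym (ℚₚ.*-distribʳ-+ (½^ n) ½ ½)) (ℚₚ.*-identityˡ (½^ n))

½^-nonNeg : ∀ n → 0ℚ ℚ.≤ ½^ n
½^-nonNeg zero    = ℚₚ.nonNegative⁻¹ 1ℚ
½^-nonNeg (suc n) =
  subst (ℚ._≤ ½ ℚ.* ½^ n) (ℚₚ.*-zeroʳ ½) (ℚₚ.*-monoˡ-≤-nonNeg ½ (½^-nonNeg n))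

abstract
  const-regular : ∀ q m n → ℚ.∣ q ℚ.- q ∣ ℚ.≤ ½^ m ℚ.+ ½^ n
  const-regular q m n =
    subst (ℚ._≤ ½^ m ℚ.+ ½^ n) (cong ℚ.∣_∣ (sym (ℚₚ.+-inverseʳ q)))
      (ℚₚ.+-mono-≤ (½^-nonNeg m) (½^-nonNeg n))

fromℚ : ℚ → ℝ
fromℚ q = mkℝ (λ _ → q) (const-regular q)

0ᴿ : ℝ
0ᴿ = fromℚ 0ℚ

abstract
  +-regular : ∀ x y m n →
    ℚ.∣ (seq x (suc m) ℚ.+ seq y (suc m)) ℚ.- (seq x (suc n) ℚ.+ seq y (suc n)) ∣
      ℚ.≤ ½^ m ℚ.+ ½^ n
  +-regular x y m n = begin
    ℚ.∣ (X m ℚ.+ Y m) ℚ.- (X n ℚ.+ Y n) ∣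
      ≡⟨ cong ℚ.∣_∣ (rearr (X m) (Y m) (X n) (Y n)) ⟩
    ℚ.∣ (X m ℚ.- X n) ℚ.+ (Y m ℚ.- Y n) ∣
      ≤⟨ ℚₚ.∣p+q∣≤∣p∣+∣q∣ (X m ℚ.- X n) (Y m ℚ.- Y n) ⟩
    ℚ.∣ X m ℚ.- X n ∣ ℚ.+ ℚ.∣ Y m ℚ.- Y n ∣
      ≤⟨ ℚₚ.+-mono-≤ (regular x (suc m) (suc n)) (regular y (suc m) (suc n)) ⟩
    (½^ suc m ℚ.+ ½^ suc n) ℚ.+ (½^ suc m ℚ.+ ½^ suc n)
      ≡⟨ swap (½^ suc m) (½^ suc n) ⟩
    (½^ suc m ℚ.+ ½^ suc m) ℚ.+ (½^ suc n ℚ.+ ½^ suc n)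
      ≡⟨ cong₂ ℚ._+_ (½^-half m) (½^-half n) ⟩
    ½^ m ℚ.+ ½^ n ∎
    where
    open ℚₚ.≤-Reasoning
    X Y : ℕ → ℚ
    X n = seq x (suc n)
    Y n = seq y (suc n)
    rearr : ∀ a b c d → (a ℚ.+ b) ℚ.- (c ℚ.+ d) ≡ (a ℚ.- c) ℚ.+ (b ℚ.- d)
    rearr = solve 4 (λ a b c d → (a :+ b) :- (c :+ d) := (a :- c) :+ (b :- d)) refl
      where open +-*-Solver
    swap : ∀ a b → (a ℚ.+ b) ℚ.+ (a ℚ.+ b) ≡ (a ℚ.+ a) ℚ.+ (b ℚ.+ b)
    swap = solve 2 (λ a b → (a :+ b) :+ (a :+ b) := (a :+ a) :+ (b :+ b)) refl
      where open +-*-Solver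

_+ᴿ_ : ℝ → ℝ → ℝ
x +ᴿ y = mkℝ (λ n → seq x (suc n) ℚ.+ seq y (suc n)) (+-regular x y)

½^-≤ : ∀ n → ½^ n ℚ.≤ (+ 1) / suc n
½^-≤ zero    = ℚₚ.≤-refl
½^-≤ (suc n) = ℚₚ.≤-trans (ℚₚ.*-monoˡ-≤-nonNeg ½ (½^-≤ n)) (ℚₚ.toℚᵘ-cancel-≤ (begin
  ℚ.toℚᵘ (½ ℚ.* ((+ 1) / suc n))
    ≃⟨ ℚₚ.toℚᵘ-homo-* ½ ((+ 1) / suc n) ⟩
  ℚ.toℚᵘ ½ ℚᵘ.* ℚ.toℚᵘ ((+ 1) / suc n)
    ≃⟨ ℚᵘₚ.*-congˡ {ℚ.toℚᵘ ½} (ℚₚ.toℚᵘ-fromℚᵘ (ℚᵘ.mkℚᵘ (+ 1) n)) ⟩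
  ℚ.toℚᵘ ½ ℚᵘ.* ℚᵘ.mkℚᵘ (+ 1) n
    ≤⟨ ℚᵘ.*≤* (ℤ.+≤+ le) ⟩
  ℚᵘ.mkℚᵘ (+ 1) (suc n)
    ≃⟨ ℚₚ.toℚᵘ-fromℚᵘ (ℚᵘ.mkℚᵘ (+ 1) (suc n)) ⟨
  ℚ.toℚᵘ ((+ 1) / suc (suc n)) ∎))
  where
  open ℚᵘₚ.≤-Reasoning
  le : suc (suc n) ℕ.+ 0 ℕ.≤ (suc n ℕ.+ (suc n ℕ.+ 0)) ℕ.+ 0
  le = ℕₚ.+-monoˡ-≤ 0 (ℕ.s≤s (ℕₚ.≤-trans (ℕ.s≤s (ℕₚ.m≤m+n n 0)) (ℕₚ.m≤n+m (suc (n ℕ.+ 0)) n)))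

½^-archimedean : ∀ {ε} → 0ℚ ℚ.< ε → ∃[ n ] ½^ n ℚ.≤ ε
½^-archimedean {ε@(ℚ.mkℚ (+ suc p) q _)} _ = q , ℚₚ.≤-trans (½^-≤ q) (ℚₚ.toℚᵘ-cancel-≤ (begin
  ℚ.toℚᵘ ((+ 1) / suc q)  ≃⟨ ℚₚ.toℚᵘ-fromℚᵘ (ℚᵘ.mkℚᵘ (+ 1) q) ⟩
  ℚᵘ.mkℚᵘ (+ 1) q         ≤⟨ ℚᵘ.*≤* (ℤ.+≤+ (ℕₚ.*-monoˡ-≤ (suc q) (ℕ.s≤s (ℕ.z≤n {p})))) ⟩
  ℚᵘ.mkℚᵘ (+ suc p) q     ∎))
  where open ℚᵘₚ.≤-Reasoning
½^-archimedean {ℚ.mkℚ (+ zero) _ _}   (ℚ.*<* (ℤ.+<+ ()))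
½^-archimedean {ℚ.mkℚ ℤ.-[1+ _ ] _ _} (ℚ.*<* ())

limit-≤ : ∀ {p q} → (∀ n → p ℚ.≤ q ℚ.+ ½^ n) → p ℚ.≤ q
limit-≤ {p} {q} h with p ℚₚ.≤? q
... | yes p≤q = p≤q
... | no  p≰q = contradiction
  (ℚₚ.≤-<-trans (ℚₚ.≤-trans (h (suc n)) (ℚₚ.+-monoʳ-≤ q (ℚₚ.*-monoˡ-≤-nonNeg ½ ½ⁿ≤ε))) gap)
  (ℚₚ.<-irrefl refl)
  where
  ε : ℚ
  ε = p ℚ.- q
  0<ε : 0ℚ ℚ.< ε
  0<ε = subst (ℚ._< ε) (ℚₚ.+-inverseʳ q) (ℚₚ.+-monoˡ-< (ℚ.- q) (ℚₚ.≰⇒> p≰q))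
  n : ℕ
  n = proj₁ (½^-archimedean 0<ε)
  ½ⁿ≤ε : ½^ n ℚ.≤ ε
  ½ⁿ≤ε = proj₂ (½^-archimedean 0<ε)
  half : ½ ℚ.* ε ℚ.< ε
  half = subst₂ ℚ._<_ (ℚₚ.*-comm ε ½) (ℚₚ.*-identityʳ ε)
    (ℚₚ.*-monoʳ-<-pos ε {{ℚ.positive 0<ε}} (ℚ.*<* (ℤ.+<+ (ℕ.s≤s (ℕ.s≤s ℕ.z≤n)))))
  cancel : ∀ q p → q ℚ.+ (p ℚ.- q) ≡ p
  cancel = solve 2 (λ q p → q :+ (p :- q) := p) refl
    where open +-*-Solver
  gap : q ℚ.+ ½ ℚ.* ε ℚ.< p
  gap = subst (q ℚ.+ ½ ℚ.* ε ℚ.<_) (cancel q p) (ℚₚ.+-monoʳ-< q half)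

p≤∣p∣ : ∀ p → p ℚ.≤ ℚ.∣ p ∣
p≤∣p∣ (ℚ.mkℚ (+ _) _ _)      = ℚₚ.≤-refl
p≤∣p∣ (ℚ.mkℚ ℤ.-[1+ _ ] _ _) = ℚ.*≤* ℤ.-≤+

regular-≤ : ∀ x m n → seq x m ℚ.≤ seq x n ℚ.+ (½^ m ℚ.+ ½^ n)
regular-≤ x m n = subst (ℚ._≤ seq x n ℚ.+ (½^ m ℚ.+ ½^ n)) (cancel (seq x n) (seq x m))
  (ℚₚ.+-monoʳ-≤ (seq x n) (ℚₚ.≤-trans (p≤∣p∣ (seq x m ℚ.- seq x n)) (regular x m n)))
  where
  cancel : ∀ q p → q ℚ.+ (p ℚ.- q) ≡ p
  cancel = solve 2 (λ q p → q :+ (p :- q) := p) refl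
    where open +-*-Solver

≤ᴿ-refl : ∀ {x} → x ≤ᴿ x
≤ᴿ-refl {x} = *≤* λ n → regular-≤ x n n

private
  -- Transitivity at a fixed index: h, u, v, w stand for ½^ (3 + k), …, ½^ k.
  chain : ∀ xn xm ym zm zn e h u v w → 0ℚ ℚ.≤ u →
    h ℚ.+ h ≡ u → u ℚ.+ u ≡ v → v ℚ.+ v ≡ w →
    xn ℚ.≤ xm ℚ.+ (e ℚ.+ h) → xm ℚ.≤ ym ℚ.+ (h ℚ.+ h) →
    ym ℚ.≤ zm ℚ.+ (h ℚ.+ h) → zm ℚ.≤ zn ℚ.+ (h ℚ.+ e) →
    xn ℚ.≤ (zn ℚ.+ (e ℚ.+ e)) ℚ.+ w
  chain xn xm ym zm zn e h u v w 0≤u hh uu vv p₁ p₂ p₃ p₄ = begin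
    xn
      ≤⟨ p₁ ⟩
    xm ℚ.+ (e ℚ.+ h)
      ≤⟨ ℚₚ.+-monoˡ-≤ (e ℚ.+ h) p₂ ⟩
    (ym ℚ.+ (h ℚ.+ h)) ℚ.+ (e ℚ.+ h)
      ≤⟨ ℚₚ.+-monoˡ-≤ (e ℚ.+ h) (ℚₚ.+-monoˡ-≤ (h ℚ.+ h) p₃) ⟩
    ((zm ℚ.+ (h ℚ.+ h)) ℚ.+ (h ℚ.+ h)) ℚ.+ (e ℚ.+ h)
      ≤⟨ ℚₚ.+-monoˡ-≤ (e ℚ.+ h) (ℚₚ.+-monoˡ-≤ (h ℚ.+ h) (ℚₚ.+-monoˡ-≤ (h ℚ.+ h) p₄)) ⟩
    (((zn ℚ.+ (h ℚ.+ e)) ℚ.+ (h ℚ.+ h)) ℚ.+ (h ℚ.+ h)) ℚ.+ (e ℚ.+ h)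
      ≡⟨ rearr zn h e ⟩
    (zn ℚ.+ (e ℚ.+ e)) ℚ.+ (((h ℚ.+ h) ℚ.+ (h ℚ.+ h)) ℚ.+ (h ℚ.+ h))
      ≡⟨ cong (λ t → (zn ℚ.+ (e ℚ.+ e)) ℚ.+ ((t ℚ.+ t) ℚ.+ t)) hh ⟩
    (zn ℚ.+ (e ℚ.+ e)) ℚ.+ ((u ℚ.+ u) ℚ.+ u)
      ≡⟨ cong (λ t → (zn ℚ.+ (e ℚ.+ e)) ℚ.+ (t ℚ.+ u)) uu ⟩
    (zn ℚ.+ (e ℚ.+ e)) ℚ.+ (v ℚ.+ u)
      ≤⟨ ℚₚ.+-monoʳ-≤ (zn ℚ.+ (e ℚ.+ e)) (ℚₚ.+-monoʳ-≤ v u≤v) ⟩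
    (zn ℚ.+ (e ℚ.+ e)) ℚ.+ (v ℚ.+ v)
      ≡⟨ cong ((zn ℚ.+ (e ℚ.+ e)) ℚ.+_) vv ⟩
    (zn ℚ.+ (e ℚ.+ e)) ℚ.+ w ∎
    where
    open ℚₚ.≤-Reasoning
    u≤v : u ℚ.≤ v
    u≤v = subst₂ ℚ._≤_ (ℚₚ.+-identityʳ u) uu (ℚₚ.+-monoʳ-≤ u 0≤u)
    rearr : ∀ z h e →
      (((z ℚ.+ (h ℚ.+ e)) ℚ.+ (h ℚ.+ h)) ℚ.+ (h ℚ.+ h)) ℚ.+ (e ℚ.+ h) ≡
      (z ℚ.+ (e ℚ.+ e)) ℚ.+ (((h ℚ.+ h) ℚ.+ (h ℚ.+ h)) ℚ.+ (h ℚ.+ h))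
    rearr z h e = trans (shuffle z e h (h ℚ.+ h))
      (cong ((z ℚ.+ (e ℚ.+ e)) ℚ.+_) (ℚₚ.+-comm (h ℚ.+ h) _))
      where
      shuffle : ∀ z e h t → (((z ℚ.+ (h ℚ.+ e)) ℚ.+ t) ℚ.+ t) ℚ.+ (e ℚ.+ h) ≡
                            (z ℚ.+ (e ℚ.+ e)) ℚ.+ ((h ℚ.+ h) ℚ.+ (t ℚ.+ t))
      shuffle = solve 4 (λ z e h t → (((z :+ (h :+ e)) :+ t) :+ t) :+ (e :+ h) :=
                                     (z :+ (e :+ e)) :+ ((h :+ h) :+ (t :+ t))) refl
        where open +-*-Solver

≤ᴿ-trans : ∀ {x y z} → x ≤ᴿ y → y ≤ᴿ z → x ≤ᴿ z
≤ᴿ-trans {x} {y} {z} (*≤* x≤y) (*≤* y≤z) = *≤* λ n → limit-≤ λ k →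
  chain (seq x n) (seq x (3 ℕ.+ k)) (seq y (3 ℕ.+ k)) (seq z (3 ℕ.+ k)) (seq z n)
    (½^ n) (½^ (3 ℕ.+ k)) (½^ (2 ℕ.+ k)) (½^ (1 ℕ.+ k)) (½^ k) (½^-nonNeg (2 ℕ.+ k))
    (½^-half (2 ℕ.+ k)) (½^-half (1 ℕ.+ k)) (½^-half k)
    (regular-≤ x n (3 ℕ.+ k)) (x≤y (3 ℕ.+ k)) (y≤z (3 ℕ.+ k)) (regular-≤ z (3 ℕ.+ k) n)

≈ᴿ-isEquivalence : IsEquivalence _≈ᴿ_
≈ᴿ-isEquivalence = record
  { refl  = ≤ᴿ-refl , ≤ᴿ-refl
  ; sym   = λ (p , q) → q , p
  ; trans = λ (p , q) (r , s) → ≤ᴿ-trans p r , ≤ᴿ-trans s q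
  }

≤ᴿ-isPartialOrder : IsPartialOrder _≈ᴿ_ _≤ᴿ_
≤ᴿ-isPartialOrder = record
  { isPreorder = record
    { isEquivalence = ≈ᴿ-isEquivalence
    ; reflexive     = proj₁
    ; trans         = ≤ᴿ-trans
    }
  ; antisym = _,_
  }

∣_-_∣≤_ : ℝ → ℝ → ℝ → Set
∣ x - y ∣≤ ε = x ≤ᴿ y +ᴿ ε × y ≤ᴿ x +ᴿ ε

UniformlyComputable : ∀ {n} → (Vec ℕ n → ℝ) → Set
UniformlyComputable {n} α =
  Σ (Vec ℕ (suc n) → ℚ) λ r → Computableℚ r ×
  (∀ k xs → ∣ α xs - fromℚ (r (k ∷ xs)) ∣≤ fromℚ (½^ k))

------------------------------------------------------------------------
-- Computable metric spaces

record ComputableMetricSpace (a ℓ : Level) : Set (lsuc (a ⊔ ℓ)) where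
  infix 4 _≈_
  field
    Carrier : Set a
    _≈_     : Rel Carrier ℓ
    d       : Carrier → Carrier → ℝ
    isMetric : IsGeneralMetric _≈_ _≈ᴿ_ _≤ᴿ_ 0ᴿ _+ᴿ_ d
    q       : ℕ → Carrier
    q-dense : ∀ x ε → 0ᴿ <ᴿ ε → ∃[ i ] d x (q i) <ᴿ ε
    d-computable : UniformlyComputable {2} λ xs →
      d (q (lookup xs Fin.zero)) (q (lookup xs (Fin.suc Fin.zero)))

record BallEnumeration : Set where
  field
    centre exponent     : ℕ → ℕ
    centre-computable   : Computable₁ centre
    exponent-computable : Computable₁ exponent
    surjective          : ∀ i j → ∃[ k ] (centre k ≡ i × exponent k ≡ j)

module _ {a ℓ} (X : ComputableMetricSpace a ℓ) where
  open ComputableMetricSpace X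

  Ball : Carrier → ℝ → Pred Carrier 0ℓ
  Ball x ε y = d x y <ᴿ ε

  Isolated : Carrier → Set (a ⊔ ℓ)
  Isolated x = ∃[ ε ] 0ᴿ <ᴿ ε × (∀ y → y ∈ Ball x ε → y ≈ x)

  Perfect : Set (a ⊔ ℓ)
  Perfect = ∀ x → ¬ Isolated x

  BasicBall : BallEnumeration → ℕ → Pred Carrier 0ℓ
  BasicBall E k = Ball (q (centre k)) (fromℚ (½^ exponent k))
    where open BallEnumeration E

  -- Π⁰₁(∅′), the open complement being generated by a Σ⁰₂ set of basic balls.
  Π⁰₁[∅′] : ∀ {c} → BallEnumeration → Pred Carrier c → Set (lsuc 0ℓ ⊔ a ⊔ c)
  Π⁰₁[∅′] E C = Σ (Pred ℕ 0ℓ) λ I → Σ⁰₂ I ×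
    (∀ x → x ∉ C ⇔ (∃[ k ] k ∈ I × x ∈ BasicBall E k))

  -- D is the set of special points with index in some c.e. set W.  As q need not
  -- be injective, W need not contain every index of every point of D.
  CESpecial : ∀ {p} → Pred Carrier p → Set (lsuc 0ℓ ⊔ a ⊔ ℓ ⊔ p)
  CESpecial D = Σ (Pred ℕ 0ℓ) λ W → CE W ×
    (∀ x → x ∈ D ⇔ (∃[ i ] i ∈ W × x ≈ q i))

  LimitPoint : ∀ {p} → Pred Carrier p → Carrier → Set (a ⊔ ℓ ⊔ p)
  LimitPoint D x = ∀ ε → 0ᴿ <ᴿ ε → ∃[ y ] y ∈ D × y ∈ Ball x ε × ¬ (y ≈ x)

{-# OPTIONS --safe #-}

-- Ball k belongs to the open complement of C iff some pair (k , s) is never refuted.  For every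
-- level (n , j), put N = n + j and search for a stage t and a special point q i with
-- 0 < d (q i) (q j) < 2⁻ⁿ which, for all k , s < N such that (k , s) is unrefuted at stage t,
-- lies outside ball k with its radius shrunk by 2⁻ᴺ.  At the first successful stage enumerate
-- the finitely many points found.
--
-- A point x ∈ C lies in no ball of the complement, so special points close enough to x are
-- eventually accepted by every level (n , j) with d x (q j) < 2⁻ⁿ, and this level contributes
-- points within 2¹⁻ⁿ of x.  If x is special, choose q j = x; otherwise these points differ
-- from x anyway.  Conversely, if (k , s) is never refuted and x is in ball k, all levels with N
-- large stay away from x, and the remaining levels contribute finitely many points.

module Submission where

open import Defs
open import Axiom.ExcludedMiddle using (ExcludedMiddle)
open import Data.Product.Base using (Σ; _×_; _,_; proj₁; proj₂; ∃; ∃-syntax)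
open import Function.Bundles using (_⇔_; mk⇔; Equivalence)
open import Level using (Level; _⊔_; Lift; lift; lower; 0ℓ)
open import Relation.Unary using (Pred; _∈_)

open import Data.Bool.Base using (if_then_else_)
open import Data.Fin.Base using (Fin; zero; suc)
open import Data.Fin.Patterns using (0F; 1F; 2F; 3F; 4F; 5F)
open import Data.Integer.Base as ℤ using (+_; _⊖_)
import Data.Integer.Properties as ℤₚ
import Data.Integer.Solver as ℤ-Solver
open import Data.Nat.Base as ℕ using (ℕ; zero; suc; s≤s)
import Data.Nat.Properties as ℕₚ
open import Data.Rational.Base as ℚ using (ℚ; 0ℚ; 1ℚ; ½; _/_)
import Data.Rational.Properties as ℚₚ
open import Data.Rational.Solver using (module +-*-Solver)
open import Data.Rational.Unnormalised.Base as ℚᵘ using (mkℚᵘ; *<*)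
import Data.Rational.Unnormalised.Properties as ℚᵘₚ
open import Data.Sum.Base using (_⊎_; inj₁; inj₂)
open import Data.Vec.Base using (Vec; []; _∷_; lookup; tabulate; tail)
open import Data.Vec.Properties using (tabulate∘lookup)
open import Data.Vec.Relation.Binary.Pointwise.Inductive as Pointwise using (Pointwise; []; _∷_)
open import Function.Base using (_∘_; id; const)
open import Function.Metric.Structures using (IsGeneralMetric)
open import Relation.Binary.Definitions using (tri<; tri≈; tri>)
open import Relation.Binary.PropositionalEquality
  using (_≡_; refl; sym; trans; cong; cong₂; subst; subst₂)
open import Relation.Binary.Structures using (IsEquivalence)
open import Relation.Nullary using (¬_; Dec; yes; no; does; contradiction)
open import Relation.Nullary.Decidable using (map′; decidable-stable)
open Equivalence using (to; from)
open ℚₚ using (+-mono-≤; +-mono-<-≤; ≤-reflexive)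

-- Computable functions

private variable
  m n : ℕ

record Computableᵛ (h : Vec ℕ n → Vec ℕ m) : Set where
  constructor mkComputableᵛ
  field
    component : ∀ i → Computable λ xs → lookup (h xs) i

open Computableᵛ

[]ᵛ : Computableᵛ {n} λ _ → []
[]ᵛ = mkComputableᵛ λ ()

infixr 5 _∷ᵛ_
_∷ᵛ_ : {f : Vec ℕ n → ℕ} {h : Vec ℕ n → Vec ℕ m} →
       Computable f → Computableᵛ h → Computableᵛ λ xs → f xs ∷ h xs
F ∷ᵛ H = mkComputableᵛ λ { zero → F ; (suc i) → component H i }

var : (i : Fin n) → Computable λ xs → lookup xs i
var i = proj i , λ _ → ⇓proj

idᵛ : Computableᵛ {n} id
idᵛ = mkComputableᵛ var

lookup-tail : (xs : Vec ℕ (suc n)) (i : Fin n) → lookup xs (suc i) ≡ lookup (tail xs) i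
lookup-tail (_ ∷ _) _ = refl

tailᵛ : {h : Vec ℕ m → Vec ℕ (suc n)} → Computableᵛ h → Computableᵛ λ xs → tail (h xs)
tailᵛ {h = h} (mkComputableᵛ H) = mkComputableᵛ λ i → proj₁ (H (suc i)) , λ xs →
  subst (proj₁ (H (suc i)) [ xs ]⇓_) (lookup-tail (h xs) i) (proj₂ (H (suc i)) xs)

compose : {g : Vec ℕ m → ℕ} {h : Vec ℕ n → Vec ℕ m} →
          Computable g → Computableᵛ h → Computable λ xs → g (h xs)
compose {h = h} (c , C) (mkComputableᵛ H) = comp c (tabulate (proj₁ ∘ H)) , λ xs →
  ⇓comp (subst (Pointwise _ _) (tabulate∘lookup (h xs))
          (Pointwise.tabulate⁺ λ i → proj₂ (H i) xs))
        (C (h xs))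

compose₁ : {g : ℕ → ℕ} {f : Vec ℕ n → ℕ} →
           Computable₁ g → Computable f → Computable λ xs → g (f xs)
compose₁ {g = g} (c , C) F =
  compose {g = λ xs → g (lookup xs 0F)} (c , λ { (x ∷ []) → C x }) (F ∷ᵛ []ᵛ)

-- The intended function `h` is given in advance, so the step equation has to be checked only at the
-- true previous value `h k xs`.
primitiveRecursion : (h : ℕ → Vec ℕ n → ℕ) {f : Vec ℕ n → ℕ} {g : Vec ℕ (2 ℕ.+ n) → ℕ} →
  (∀ xs → f xs ≡ h 0 xs) → (∀ k xs → g (k ∷ h k xs ∷ xs) ≡ h (suc k) xs) →
  Computable f → Computable g →
  {b : Vec ℕ n → ℕ} → Computable b → Computable λ xs → h (b xs) xs
primitiveRecursion {n} h base step (cf , F) (cg , G) B =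
  compose {g = λ { (k ∷ xs) → h k xs }} (prec cf cg , λ { (k ∷ xs) → run k xs }) (B ∷ᵛ idᵛ)
  where
  run : ∀ k xs → prec cf cg [ k ∷ xs ]⇓ h k xs
  run zero    xs = ⇓prec-zero (subst (cf [ xs ]⇓_) (base xs) (F xs))
  run (suc k) xs = ⇓prec-suc (run k xs)
    (subst (cg [ k ∷ h k xs ∷ xs ]⇓_) (step k xs) (G (k ∷ h k xs ∷ xs)))

constant : ∀ k → Computable {n} λ _ → k
constant zero    = zeroᶜ , λ _ → ⇓zero
constant (suc k) = compose₁ (sucᶜ , λ _ → ⇓suc) (constant k)

sucᶠ : {f : Vec ℕ n → ℕ} → Computable f → Computable λ xs → suc (f xs)
sucᶠ = compose₁ (sucᶜ , λ _ → ⇓suc)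

weaken₂ : {f : Vec ℕ n → ℕ} → Computable f → Computable λ xs → f (tail (tail xs))
weaken₂ F = compose F (tailᵛ (tailᵛ idᵛ))

module _ {f g : Vec ℕ n → ℕ} (F : Computable f) (G : Computable g) where

  _+ᶠ_ : Computable λ xs → f xs ℕ.+ g xs
  _+ᶠ_ = primitiveRecursion (λ k xs → k ℕ.+ g xs) (λ _ → refl) (λ _ _ → refl)
    G (sucᶠ (var 1F)) F

pred-computable : Computable₁ ℕ.pred
pred-computable = proj₁ P , λ x → proj₂ P (x ∷ [])
  where
  P : Computable {1} λ xs → ℕ.pred (lookup xs 0F)
  P = primitiveRecursion (λ k _ → ℕ.pred k) (λ _ → refl) (λ _ _ → refl)
        (constant 0) (var 0F) (var 0F)

module _ {f g : Vec ℕ n → ℕ} (F : Computable f) (G : Computable g) where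

  _*ᶠ_ : Computable λ xs → f xs ℕ.* g xs
  _*ᶠ_ = primitiveRecursion (λ k xs → k ℕ.* g xs) (λ _ → refl) (λ _ _ → refl)
    (constant 0) (weaken₂ G +ᶠ var 1F) F

  _∸ᶠ_ : Computable λ xs → f xs ℕ.∸ g xs
  _∸ᶠ_ = primitiveRecursion (λ k xs → f xs ℕ.∸ k) (λ _ → refl)
    (λ k xs → ℕₚ.pred[m∸n]≡m∸[1+n] (f xs) k)
    F (compose₁ pred-computable (var 1F)) G

2^ᶠ : {f : Vec ℕ n → ℕ} → Computable f → Computable λ xs → 2 ℕ.^ f xs
2^ᶠ = primitiveRecursion (λ k _ → 2 ℕ.^ k) (λ _ → refl) (λ _ _ → refl)
  (constant 1) (constant 2 *ᶠ var 1F)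

-- The step function of a primitive recursion sees counter, previous value and parameters; a
-- predicate under a bounded quantifier must skip the previous value.
dropSecond : {f : Vec ℕ (suc n) → ℕ} → Computable f →
             Computable λ xs → f (lookup xs 0F ∷ tail (tail xs))
dropSecond F = compose F (var 0F ∷ᵛ tailᵛ (tailᵛ idᵛ))

-- Recursive predicates, in the form of the zero set of a computable function

record Recursive {n} (P : Vec ℕ n → Set) : Set where
  constructor mkRecursive
  field
    χ            : Vec ℕ n → ℕ
    χ-computable : Computable χ
    zeros        : ∀ xs → P xs ⇔ χ xs ≡ 0

open Recursive

fromComputablePred : {P : Vec ℕ n → Set} → ComputablePred P → Recursive P
fromComputablePred {P = P} (P? , P-computable) = mkRecursive _ (constant 1 ∸ᶠ P-computable) zeros′
  where
  zeros′ : ∀ xs → P xs ⇔ 1 ℕ.∸ (if does (P? xs) then 1 else 0) ≡ 0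
  zeros′ xs with P? xs
  ... | yes p = mk⇔ (const refl) (const p)
  ... | no ¬p = mk⇔ (λ p → contradiction p ¬p) (λ ())

substitute : {P : Vec ℕ m → Set} {h : Vec ℕ n → Vec ℕ m} →
             Recursive P → Computableᵛ h → Recursive λ xs → P (h xs)
substitute {h = h} (mkRecursive χ X Z) H = mkRecursive (χ ∘ h) (compose X H) (Z ∘ h)

<-recursive : {f g : Vec ℕ n → ℕ} → Computable f → Computable g →
              Recursive λ xs → f xs ℕ.< g xs
<-recursive F G = mkRecursive _ (sucᶠ F ∸ᶠ G) λ xs →
  mk⇔ ℕₚ.m≤n⇒m∸n≡0 ℕₚ.m∸n≡0⇒m≤n

module _ {P Q : Vec ℕ n → Set} (RP : Recursive P) (RQ : Recursive Q) where

  infixr 3 _∧ʳ_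
  infixr 2 _⇒ʳ_

  _∧ʳ_ : Recursive λ xs → P xs × Q xs
  _∧ʳ_ = mkRecursive _ (χ-computable RP +ᶠ χ-computable RQ) λ xs → mk⇔
    (λ (p , q) → cong₂ ℕ._+_ (to (zeros RP xs) p) (to (zeros RQ xs) q))
    (λ z → from (zeros RP xs) (ℕₚ.m+n≡0⇒m≡0 _ z) ,
           from (zeros RQ xs) (ℕₚ.m+n≡0⇒n≡0 (χ RP xs) z))

  _⇒ʳ_ : Recursive λ xs → P xs → Q xs
  _⇒ʳ_ = mkRecursive _ ((constant 1 ∸ᶠ χ-computable RP) *ᶠ χ-computable RQ) λ xs →
    mk⇔ (forth xs) (back xs)
    where
    forth : ∀ xs → (P xs → Q xs) → (1 ℕ.∸ χ RP xs) ℕ.* χ RQ xs ≡ 0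
    forth xs p⇒q with χ RP xs in eq
    ... | zero  = trans (ℕₚ.+-identityʳ _) (to (zeros RQ xs) (p⇒q (from (zeros RP xs) eq)))
    ... | suc k = cong (ℕ._* χ RQ xs) (ℕₚ.0∸n≡0 k)
    back : ∀ xs → (1 ℕ.∸ χ RP xs) ℕ.* χ RQ xs ≡ 0 → P xs → Q xs
    back xs z p rewrite to (zeros RP xs) p = from (zeros RQ xs) (trans (sym (ℕₚ.+-identityʳ _)) z)

¬ʳ_ : {P : Vec ℕ n → Set} → Recursive P → Recursive λ xs → ¬ P xs
¬ʳ_ {P = P} RP = mkRecursive _ (constant 1 ∸ᶠ χ-computable RP) λ xs → mk⇔ (forth xs) (back xs)
  where
  forth : ∀ xs → ¬ P xs → 1 ℕ.∸ χ RP xs ≡ 0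
  forth xs ¬p with χ RP xs in eq
  ... | zero  = contradiction (from (zeros RP xs) eq) ¬p
  ... | suc k = ℕₚ.0∸n≡0 k
  back : ∀ xs → 1 ℕ.∸ χ RP xs ≡ 0 → ¬ P xs
  back xs z p rewrite to (zeros RP xs) p = ℕₚ.1+n≢0 z

module _ {P : Vec ℕ (suc n) → Set} (RP : Recursive P) {b : Vec ℕ n → ℕ} (B : Computable b) where

  private
    -- Truth is coded by 0, so a sum acts as the universal quantifier and a product as the
    -- existential one. The empty cases 0 and 1 are accordingly true and false.
    Σχ Πχ : ℕ → Vec ℕ n → ℕ
    Σχ zero    xs = 0
    Σχ (suc k) xs = χ RP (k ∷ xs) ℕ.+ Σχ k xs
    Πχ zero    xs = 1
    Πχ (suc k) xs = χ RP (k ∷ xs) ℕ.* Πχ k xs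

    ∀⇒Σχ≡0 : ∀ k xs → (∀ z → z ℕ.< k → P (z ∷ xs)) → Σχ k xs ≡ 0
    ∀⇒Σχ≡0 zero    xs h = refl
    ∀⇒Σχ≡0 (suc k) xs h = cong₂ ℕ._+_ (to (zeros RP _) (h k ℕₚ.≤-refl))
      (∀⇒Σχ≡0 k xs λ z z<k → h z (ℕₚ.m<n⇒m<1+n z<k))

    Σχ≡0⇒∀ : ∀ k xs → Σχ k xs ≡ 0 → ∀ z → z ℕ.< k → P (z ∷ xs)
    Σχ≡0⇒∀ (suc k) xs eq z z<1+k with ℕₚ.m≤n⇒m<n∨m≡n (ℕₚ.≤-pred z<1+k)
    ... | inj₁ z<k  = Σχ≡0⇒∀ k xs (ℕₚ.m+n≡0⇒n≡0 (χ RP (k ∷ xs)) eq) z z<k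
    ... | inj₂ refl = from (zeros RP _) (ℕₚ.m+n≡0⇒m≡0 _ eq)

    ∃⇒Πχ≡0 : ∀ k xs z → z ℕ.< k → P (z ∷ xs) → Πχ k xs ≡ 0
    ∃⇒Πχ≡0 (suc k) xs z z<1+k p with ℕₚ.m≤n⇒m<n∨m≡n (ℕₚ.≤-pred z<1+k)
    ... | inj₁ z<k  = trans (cong (χ RP (k ∷ xs) ℕ.*_) (∃⇒Πχ≡0 k xs z z<k p)) (ℕₚ.*-zeroʳ (χ RP (k ∷ xs)))
    ... | inj₂ refl = cong (ℕ._* Πχ k xs) (to (zeros RP _) p)

    Πχ≡0⇒∃ : ∀ k xs → Πχ k xs ≡ 0 → ∃[ z ] z ℕ.< k × P (z ∷ xs)
    Πχ≡0⇒∃ (suc k) xs eq with ℕₚ.m*n≡0⇒m≡0∨n≡0 (χ RP (k ∷ xs)) eq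
    ... | inj₁ eq₁ = k , ℕₚ.≤-refl , from (zeros RP _) eq₁
    ... | inj₂ eq₂ with Πχ≡0⇒∃ k xs eq₂
    ...   | z , z<k , p = z , ℕₚ.m<n⇒m<1+n z<k , p

  bounded-∀ : Recursive λ xs → ∀ z → z ℕ.< b xs → P (z ∷ xs)
  bounded-∀ = mkRecursive (λ xs → Σχ (b xs) xs)
    (primitiveRecursion Σχ (λ _ → refl) (λ _ _ → refl) (constant 0)
      (dropSecond (χ-computable RP) +ᶠ var 1F) B)
    λ xs → mk⇔ (∀⇒Σχ≡0 (b xs) xs) (Σχ≡0⇒∀ (b xs) xs)

  bounded-∃ : Recursive λ xs → ∃[ z ] z ℕ.< b xs × P (z ∷ xs)
  bounded-∃ = mkRecursive (λ xs → Πχ (b xs) xs)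
    (primitiveRecursion Πχ (λ _ → refl) (λ _ _ → refl) (constant 1)
      (dropSecond (χ-computable RP) *ᶠ var 1F) B)
    λ xs → mk⇔ (λ (z , z<b , p) → ∃⇒Πχ≡0 (b xs) xs z z<b p) (Πχ≡0⇒∃ (b xs) xs)

-- C.e. sets as projections of recursive predicates

-- A halting minimisation yields only a derivation that its body takes the value 0; determinism
-- identifies that 0 with the value of the characteristic function.
⇓-deterministic : (c : Code n) → ∀ {xs y z} → c [ xs ]⇓ y → c [ xs ]⇓ z → y ≡ z
⇓-deterministicᵛ : (cs : Vec (Code n) m) → ∀ {xs ys zs} →
  Pointwise (λ c y → c [ xs ]⇓ y) cs ys → Pointwise (λ c y → c [ xs ]⇓ y) cs zs → ys ≡ zs

⇓-deterministic zeroᶜ    ⇓zero ⇓zero = refl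
⇓-deterministic sucᶜ     ⇓suc  ⇓suc  = refl
⇓-deterministic (proj i) ⇓proj ⇓proj = refl
⇓-deterministic (comp f gs) (⇓comp ds d) (⇓comp es e)
  rewrite ⇓-deterministicᵛ gs ds es = ⇓-deterministic f d e
⇓-deterministic (prec f g) (⇓prec-zero d) (⇓prec-zero e) = ⇓-deterministic f d e
⇓-deterministic (prec f g) (⇓prec-suc d d′) (⇓prec-suc e e′)
  rewrite ⇓-deterministic (prec f g) d e = ⇓-deterministic g d′ e′
⇓-deterministic (min f) {y = y} {z} (⇓min d d<) (⇓min e e<) with ℕₚ.<-cmp y z
... | tri≈ _ y≡z _ = y≡z
... | tri< y<z _ _ = contradiction (⇓-deterministic f d (proj₂ (e< y y<z))) λ ()
... | tri> _ _ z<y = contradiction (⇓-deterministic f e (proj₂ (d< z z<y))) λ ()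

⇓-deterministicᵛ []       []       []       = refl
⇓-deterministicᵛ (c ∷ cs) (d ∷ ds) (e ∷ es) =
  cong₂ _∷_ (⇓-deterministic c d e) (⇓-deterministicᵛ cs ds es)

-- The search below `u` either meets a least element or shows that there is none, in which case `u`
-- itself is least.
least : {P : ℕ → Set} → (∀ u → Dec (P u)) → ∀ u → P u →
        ∃[ v ] P v × (∀ z → z ℕ.< v → ¬ P z)
least {P} P? u p with search u
  where
  search : ∀ u → (∃[ v ] P v × (∀ z → z ℕ.< v → ¬ P z)) ⊎ (∀ z → z ℕ.< u → ¬ P z)
  search zero = inj₂ λ _ ()
  search (suc u) with search u
  ... | inj₁ found = inj₁ found
  ... | inj₂ none with P? u
  ...   | yes p = inj₁ (u , p , none)
  ...   | no ¬p = inj₂ λ z z<1+u → case-< z (ℕₚ.m≤n⇒m<n∨m≡n (ℕₚ.≤-pred z<1+u))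
    where
    case-< : ∀ z → z ℕ.< u ⊎ z ≡ u → ¬ P z
    case-< z (inj₁ z<u)  = none z z<u
    case-< z (inj₂ refl) = ¬p
... | inj₁ found = found
... | inj₂ none  = u , p , none

∃-CE : {P : Vec ℕ 2 → Set} → Recursive P → CE λ x → ∃[ u ] P (u ∷ x ∷ [])
∃-CE {P} (mkRecursive χ (c , C) Z) = min c , λ x → mk⇔ (halts x) (sound x)
  where
  halts : ∀ x → ∃[ u ] P (u ∷ x ∷ []) → ∃[ y ] min c [ x ∷ [] ]⇓ y
  halts x (u , p) with least (λ u → χ (u ∷ x ∷ []) ℕₚ.≟ 0) u (to (Z _) p)
  ... | v , χ≡0 , minimal = v , ⇓min (subst (c [ _ ]⇓_) χ≡0 (C _)) λ z z<v →
    ℕ.pred (χ (z ∷ x ∷ [])) ,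
    subst (c [ _ ]⇓_) (sym (ℕₚ.suc-pred _ {{ℕ.≢-nonZero (minimal z z<v)}})) (C _)
  sound : ∀ x → ∃[ y ] min c [ x ∷ [] ]⇓ y → ∃[ u ] P (u ∷ x ∷ [])
  sound x (y , ⇓min d _) = y , from (Z _) (⇓-deterministic c (C _) d)

mapCE : {V W : ℕ → Set} → (∀ x → W x ⇔ V x) → CE V → CE W
mapCE W⇔V (c , C) = c , λ x → mk⇔ (to (C x) ∘ to (W⇔V x)) (from (W⇔V x) ∘ from (C x))

-- One unbounded number bounding all three witnesses replaces them: the search below it is
-- recursive, so no pairing function enters.
∃₃-CE : {P : Vec ℕ 4 → Set} → Recursive P →
        CE λ x → ∃[ k ] ∃[ l ] ∃[ m ] P (k ∷ l ∷ m ∷ x ∷ [])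
∃₃-CE {P} RP = mapCE (λ x → mk⇔ (bound x) (λ (_ , k , _ , l , _ , m , _ , p) → k , l , m , p))
  (∃-CE (bounded-∃
    {P = λ xs → ∃[ l ] l ℕ.< lookup xs 1F × (∃[ m ] m ℕ.< lookup xs 1F ×
                P (lookup xs 0F ∷ l ∷ m ∷ lookup xs 2F ∷ []))}
    (bounded-∃
      {P = λ xs → ∃[ m ] m ℕ.< lookup xs 2F ×
                  P (lookup xs 1F ∷ lookup xs 0F ∷ m ∷ lookup xs 3F ∷ [])}
      (bounded-∃ (substitute RP (var 2F ∷ᵛ var 1F ∷ᵛ var 0F ∷ᵛ var 4F ∷ᵛ []ᵛ)) (var 2F))
      (var 1F)) (var 0F)))
  where
  bound : ∀ x → ∃[ k ] ∃[ l ] ∃[ m ] P (k ∷ l ∷ m ∷ x ∷ []) → _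
  bound x (k , l , m , p) = suc (k ℕ.+ l ℕ.+ m) ,
    k , s≤s (ℕₚ.≤-trans (ℕₚ.m≤m+n k l) (ℕₚ.m≤m+n (k ℕ.+ l) m)) ,
    l , s≤s (ℕₚ.≤-trans (ℕₚ.m≤n+m l k) (ℕₚ.m≤m+n (k ℕ.+ l) m)) ,
    m , s≤s (ℕₚ.m≤n+m m (k ℕ.+ l)) , p

-- Computable rational functions

pos-⊖ : ∀ a b s → (a ⊖ b) ℤ.* + s ≡ + (a ℕ.* s) ℤ.- + (b ℕ.* s)
pos-⊖ a b s = trans (cong (ℤ._* + s) (sym (ℤₚ.[+m]-[+n]≡m⊖n a b)))
  (trans (distrib (+ a) (+ b) (+ s)) (cong₂ ℤ._-_ (sym (ℤₚ.pos-* a s)) (sym (ℤₚ.pos-* b s))))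
  where
  open ℤ-Solver.+-*-Solver
  distrib : ∀ a b s → (a ℤ.- b) ℤ.* s ≡ a ℤ.* s ℤ.- b ℤ.* s
  distrib = solve 3 (λ a b s → (a :- b) :* s := a :* s :- b :* s) refl

⊖-+ : ∀ a b a′ b′ s s′ → (a ⊖ b) ℤ.* + s′ ℤ.+ (a′ ⊖ b′) ℤ.* + s ≡
      (a ℕ.* s′ ℕ.+ a′ ℕ.* s) ⊖ (b ℕ.* s′ ℕ.+ b′ ℕ.* s)
⊖-+ a b a′ b′ s s′ = trans (cong₂ ℤ._+_ (pos-⊖ a b s′) (pos-⊖ a′ b′ s))
  (trans (rearrange (+ (a ℕ.* s′)) (+ (b ℕ.* s′)) (+ (a′ ℕ.* s)) (+ (b′ ℕ.* s)))
    (ℤₚ.[+m]-[+n]≡m⊖n (a ℕ.* s′ ℕ.+ a′ ℕ.* s) (b ℕ.* s′ ℕ.+ b′ ℕ.* s)))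
  where
  open ℤ-Solver.+-*-Solver
  rearrange : ∀ a b a′ b′ → (a ℤ.- b) ℤ.+ (a′ ℤ.- b′) ≡ (a ℤ.+ a′) ℤ.- (b ℤ.+ b′)
  rearrange = solve 4 (λ a b a′ b′ → (a :- b) :+ (a′ :- b′) := (a :+ a′) :- (b :+ b′)) refl

-- Adding both subtracted terms, `w`, to the two sides leaves a comparison of natural numbers, which
-- is recursive.
⊖-< : ∀ a b a′ b′ s s′ → (a ⊖ b) ℤ.* + s′ ℤ.< (a′ ⊖ b′) ℤ.* + s ⇔
      a ℕ.* s′ ℕ.+ b′ ℕ.* s ℕ.< a′ ℕ.* s ℕ.+ b ℕ.* s′
⊖-< a b a′ b′ s s′ rewrite pos-⊖ a b s′ | pos-⊖ a′ b′ s = mk⇔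
  (λ lt → ℤₚ.drop‿+<+ (subst₂ ℤ._<_ eq₁ eq₂ (ℤₚ.+-monoˡ-< w lt)))
  (λ lt → subst₂ ℤ._<_ (cancel x w) (cancel y w)
    (ℤₚ.+-monoˡ-< (ℤ.- w) (subst₂ ℤ._<_ (sym eq₁) (sym eq₂) (ℤ.+<+ lt))))
  where
  open ℤ-Solver.+-*-Solver
  as bs as′ bs′ w x y : ℤ.ℤ
  as = + (a ℕ.* s′)
  bs = + (b ℕ.* s′)
  as′ = + (a′ ℕ.* s)
  bs′ = + (b′ ℕ.* s)
  w = bs ℤ.+ bs′
  x = as ℤ.- bs
  y = as′ ℤ.- bs′
  eq₁ : x ℤ.+ w ≡ as ℤ.+ bs′
  eq₁ = solve 3 (λ a b b′ → (a :- b) :+ (b :+ b′) := a :+ b′) refl as bs bs′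
  eq₂ : y ℤ.+ w ≡ as′ ℤ.+ bs
  eq₂ = solve 3 (λ a b b′ → (a :- b) :+ (b′ :+ b) := a :+ b′) refl as′ bs′ bs
  cancel : ∀ x w → (x ℤ.+ w) ℤ.+ (ℤ.- w) ≡ x
  cancel = solve 2 (λ x w → (x :+ w) :+ (:- w) := x) refl

-- `suc c * suc c′` computes to the successor used as denominator, so the sum is again of the form
-- that `Computableℚ` asks for.
fraction-+ : ∀ a b c a′ b′ c′ → (a ⊖ b) / suc c ℚ.+ (a′ ⊖ b′) / suc c′ ≡
  ((a ℕ.* suc c′ ℕ.+ a′ ℕ.* suc c) ⊖ (b ℕ.* suc c′ ℕ.+ b′ ℕ.* suc c)) / suc (c′ ℕ.+ c ℕ.* suc c′)
fraction-+ a b c a′ b′ c′ = ℚₚ.toℚᵘ-injective (begin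
  ℚ.toℚᵘ ((a ⊖ b) / suc c ℚ.+ (a′ ⊖ b′) / suc c′)
    ≈⟨ ℚₚ.toℚᵘ-homo-+ ((a ⊖ b) / suc c) ((a′ ⊖ b′) / suc c′) ⟩
  ℚ.toℚᵘ ((a ⊖ b) / suc c) ℚᵘ.+ ℚ.toℚᵘ ((a′ ⊖ b′) / suc c′)
    ≈⟨ ℚᵘₚ.+-cong (ℚₚ.toℚᵘ-fromℚᵘ (mkℚᵘ (a ⊖ b) c)) (ℚₚ.toℚᵘ-fromℚᵘ (mkℚᵘ (a′ ⊖ b′) c′)) ⟩
  mkℚᵘ (a ⊖ b) c ℚᵘ.+ mkℚᵘ (a′ ⊖ b′) c′
    ≡⟨ cong (λ i → mkℚᵘ i (c′ ℕ.+ c ℕ.* suc c′)) (⊖-+ a b a′ b′ (suc c) (suc c′)) ⟩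
  mkℚᵘ numerator (c′ ℕ.+ c ℕ.* suc c′)
    ≈⟨ ℚₚ.toℚᵘ-fromℚᵘ (mkℚᵘ numerator (c′ ℕ.+ c ℕ.* suc c′)) ⟨
  ℚ.toℚᵘ (numerator / suc (c′ ℕ.+ c ℕ.* suc c′)) ∎)
  where
  open ℚᵘₚ.≃-Reasoning
  numerator = (a ℕ.* suc c′ ℕ.+ a′ ℕ.* suc c) ⊖ (b ℕ.* suc c′ ℕ.+ b′ ℕ.* suc c)

fraction-< : ∀ a b c a′ b′ c′ → (a ⊖ b) / suc c ℚ.< (a′ ⊖ b′) / suc c′ ⇔
  a ℕ.* suc c′ ℕ.+ b′ ℕ.* suc c ℕ.< a′ ℕ.* suc c ℕ.+ b ℕ.* suc c′
fraction-< a b c a′ b′ c′ = mk⇔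
  (λ lt → to (⊖-< a b a′ b′ (suc c) (suc c′)) (ℚᵘₚ.drop-*<*
    (ℚᵘₚ.<-respˡ-≃ p≃ (ℚᵘₚ.<-respʳ-≃ q≃ (ℚₚ.toℚᵘ-mono-< lt)))))
  (λ lt → ℚₚ.toℚᵘ-cancel-< (ℚᵘₚ.<-respˡ-≃ (ℚᵘₚ.≃-sym p≃) (ℚᵘₚ.<-respʳ-≃ (ℚᵘₚ.≃-sym q≃)
    (*<* (from (⊖-< a b a′ b′ (suc c) (suc c′)) lt)))))
  where
  p≃ = ℚₚ.toℚᵘ-fromℚᵘ (mkℚᵘ (a ⊖ b) c)
  q≃ = ℚₚ.toℚᵘ-fromℚᵘ (mkℚᵘ (a′ ⊖ b′) c′)

module _ {r s : Vec ℕ n → ℚ} where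

  infixl 6 _+ʳ_
  infix 4 _<ʳ_

  _+ʳ_ : Computableℚ r → Computableℚ s → Computableℚ λ xs → r xs ℚ.+ s xs
  (a , b , c , A , B , C , r≡) +ʳ (a′ , b′ , c′ , A′ , B′ , C′ , s≡) =
    _ , _ , _ ,
    ((A *ᶠ sucᶠ C′) +ᶠ (A′ *ᶠ sucᶠ C)) , ((B *ᶠ sucᶠ C′) +ᶠ (B′ *ᶠ sucᶠ C)) , (C′ +ᶠ (C *ᶠ sucᶠ C′)) ,
    λ xs → trans (cong₂ ℚ._+_ (r≡ xs) (s≡ xs))
      (fraction-+ (a xs) (b xs) (c xs) (a′ xs) (b′ xs) (c′ xs))

  _<ʳ_ : Computableℚ r → Computableℚ s → Recursive λ xs → r xs ℚ.< s xs
  (a , b , c , A , B , C , r≡) <ʳ (a′ , b′ , c′ , A′ , B′ , C′ , s≡) =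
    mkRecursive (χ R) (χ-computable R) λ xs → mk⇔
      (λ lt → to (zeros R xs) (to (lemma xs) (subst₂ ℚ._<_ (r≡ xs) (s≡ xs) lt)))
      (λ z → subst₂ ℚ._<_ (sym (r≡ xs)) (sym (s≡ xs)) (from (lemma xs) (from (zeros R xs) z)))
    where
    R = <-recursive ((A *ᶠ sucᶠ C′) +ᶠ (B′ *ᶠ sucᶠ C)) ((A′ *ᶠ sucᶠ C) +ᶠ (B *ᶠ sucᶠ C′))
    lemma = λ xs → fraction-< (a xs) (b xs) (c xs) (a′ xs) (b′ xs) (c′ xs)

½^-fraction : ∀ k → ½^ k ≡ (1 ⊖ 0) / suc (2 ℕ.^ k ℕ.∸ 1)
½^-fraction zero    = refl
½^-fraction (suc k) = ℚₚ.toℚᵘ-injective (begin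
  ℚ.toℚᵘ (½ ℚ.* ½^ k)
    ≈⟨ ℚₚ.toℚᵘ-homo-* ½ (½^ k) ⟩
  ℚ.toℚᵘ ½ ℚᵘ.* ℚ.toℚᵘ (½^ k)
    ≡⟨ cong (λ p → ℚ.toℚᵘ ½ ℚᵘ.* ℚ.toℚᵘ p) (½^-fraction k) ⟩
  ℚ.toℚᵘ ½ ℚᵘ.* ℚ.toℚᵘ ((1 ⊖ 0) / suc (2 ℕ.^ k ℕ.∸ 1))
    ≈⟨ ℚᵘₚ.*-congˡ {ℚ.toℚᵘ ½} (ℚₚ.toℚᵘ-fromℚᵘ (mkℚᵘ (+ 1) (2 ℕ.^ k ℕ.∸ 1))) ⟩
  ℚ.toℚᵘ ½ ℚᵘ.* mkℚᵘ (+ 1) (2 ℕ.^ k ℕ.∸ 1)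
    ≡⟨ cong (mkℚᵘ (+ 1)) (denominator (2 ℕ.^ k) (ℕₚ.m^n>0 2 k)) ⟩
  mkℚᵘ (+ 1) (2 ℕ.^ suc k ℕ.∸ 1)
    ≈⟨ ℚₚ.toℚᵘ-fromℚᵘ (mkℚᵘ (+ 1) (2 ℕ.^ suc k ℕ.∸ 1)) ⟨
  ℚ.toℚᵘ ((1 ⊖ 0) / suc (2 ℕ.^ suc k ℕ.∸ 1)) ∎)
  where
  open ℚᵘₚ.≃-Reasoning
  denominator : ∀ N → 0 ℕ.< N → ℕ.pred (2 ℕ.* suc (N ℕ.∸ 1)) ≡ 2 ℕ.* N ℕ.∸ 1
  denominator (suc N) _ = refl

½^ᶠ : {f : Vec ℕ n → ℕ} → Computable f → Computableℚ λ xs → ½^ f xs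
½^ᶠ {f = f} F = _ , _ , _ , constant 1 , constant 0 , (2^ᶠ F ∸ᶠ constant 1) , λ xs → ½^-fraction (f xs)

-- Rational inequalities

-p+[p+a]≡a : ∀ p a → ℚ.- p ℚ.+ (p ℚ.+ a) ≡ a
-p+[p+a]≡a = solve 2 (λ p a → (:- p) :+ (p :+ a) := a) refl
  where open +-*-Solver

-- Linear arithmetic: a < b follows from a sum p < q of inequalities with b − a = q − p,
-- stated without subtraction.
<-by-difference : ∀ {a b p q} → p ℚ.< q → p ℚ.+ b ≡ q ℚ.+ a → a ℚ.< b
<-by-difference {a} {b} {p} {q} p<q eq = subst₂ ℚ._<_ (-p+[p+a]≡a p a) (-p+[p+a]≡a p b)
  (ℚₚ.+-monoʳ-< (ℚ.- p) (subst (p ℚ.+ a ℚ.<_) (sym eq) (ℚₚ.+-monoˡ-< a p<q)))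

≤-by-difference : ∀ {a b p q} → p ℚ.≤ q → p ℚ.+ b ≡ q ℚ.+ a → a ℚ.≤ b
≤-by-difference {a} {b} {p} {q} p≤q eq = subst₂ ℚ._≤_ (-p+[p+a]≡a p a) (-p+[p+a]≡a p b)
  (ℚₚ.+-monoʳ-≤ (ℚ.- p) (subst (p ℚ.+ a ℚ.≤_) (sym eq) (ℚₚ.+-monoˡ-≤ a p≤q)))

p-r+r≡p : ∀ p r → (p ℚ.- r) ℚ.+ r ≡ p
p-r+r≡p = solve 2 (λ p r → (p :- r) :+ r := p) refl
  where open +-*-Solver

½^-quarter : ∀ m → (½^ (2 ℕ.+ m) ℚ.+ ½^ (2 ℕ.+ m)) ℚ.+ (½^ (2 ℕ.+ m) ℚ.+ ½^ (2 ℕ.+ m)) ≡ ½^ m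
½^-quarter m = trans (cong₂ ℚ._+_ (½^-half (1 ℕ.+ m)) (½^-half (1 ℕ.+ m))) (½^-half m)

½^-step : ∀ m → ½^ suc m ℚ.≤ ½^ m
½^-step m = subst₂ ℚ._≤_ (ℚₚ.+-identityʳ (½^ suc m)) (½^-half m)
  (ℚₚ.+-monoʳ-≤ (½^ suc m) (½^-nonNeg (suc m)))

½^-antitone : ∀ {m n} → m ℕ.≤ n → ½^ n ℚ.≤ ½^ m
½^-antitone = go ∘ ℕₚ.≤⇒≤′
  where
  go : ∀ {m n} → m ℕ.≤′ n → ½^ n ℚ.≤ ½^ m
  go ℕ.≤′-refl       = ℚₚ.≤-refl
  go (ℕ.≤′-step {n} m≤n) = ℚₚ.≤-trans (½^-step n) (go m≤n)

½^-positive : ∀ m → 0ℚ ℚ.< ½^ m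
½^-positive zero    = ℚₚ.positive⁻¹ 1ℚ
½^-positive (suc m) = subst (ℚ._< ½^ suc m) (ℚₚ.*-zeroʳ ½) (ℚₚ.*-monoʳ-<-pos ½ (½^-positive m))

½^-strict : ∀ m → ½^ suc m ℚ.< ½^ m
½^-strict m = subst₂ ℚ._<_ (ℚₚ.+-identityʳ (½^ suc m)) (½^-half m)
  (ℚₚ.+-monoʳ-< (½^ suc m) (½^-positive (suc m)))

½^-gap : ∀ {p q} → p ℚ.< q → ∃[ m ] p ℚ.+ ½^ m ℚ.< q
½^-gap {p} {q} p<q =
  let m , ½ᵐ≤q-p = ½^-archimedean 0<q-p in
  -- The Archimedean bound is weak; halving once more makes it strict.
  suc m , <-by-difference (+-mono-<-≤ (½^-strict m) ½ᵐ≤q-p)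
    (solve 4 (λ p q h w → (h :+ w) :+ q := (w :+ (q :- p)) :+ (p :+ h)) refl p q (½^ suc m) (½^ m))
  where
  open +-*-Solver
  0<q-p : 0ℚ ℚ.< q ℚ.- p
  0<q-p = <-by-difference p<q (solve 2 (λ p q → p :+ (q :- p) := q :+ con 0ℚ) refl p q)

-- Rational upper bounds of real numbers

infix 4 _≺_ _≼_

_≺_ : ℝ → ℚ → Set
x ≺ p = x <ᴿ fromℚ p

-- This is the weak order against `fromℚ p`, with a single `½^ n` of slack because `p` is exact.
-- Bounds then add without loss, as `_+ᴿ_` reads its summands one index later.
record _≼_ (x : ℝ) (p : ℚ) : Set where
  constructor mk≼
  field
    bound : ∀ n → seq x n ℚ.≤ p ℚ.+ ½^ n

open _≼_

module _ where
  open +-*-Solver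

  -- An approximation plus its error bounds `x`, and the doubled error in `_<ᴿ_` keeps this bound
  -- strictly below `p`. Strict bounds thus carry rational slack.
  ≺⇒≼ : ∀ {x p} → x ≺ p → ∃[ p′ ] p′ ℚ.< p × x ≼ p′
  ≺⇒≼ {x} {p} (*<* n lt) = seq x n ℚ.+ ½^ n ,
    <-by-difference (+-mono-<-≤ lt (½^-nonNeg n))
      (solve 3 (λ s e p → ((s :+ (e :+ e)) :+ con 0ℚ) :+ p := (p :+ e) :+ (s :+ e)) refl (seq x n) (½^ n) p) ,
    mk≼ λ m → ≤-by-difference (regular-≤ x m n)
      (solve 4 (λ s t d e → s :+ ((t :+ e) :+ d) := (t :+ (d :+ e)) :+ s) refl (seq x m) (seq x n) (½^ m) (½^ n))

  ≼⇒≺ : ∀ {x p p′} → x ≼ p′ → p′ ℚ.< p → x ≺ p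
  ≼⇒≺ {x} {p} {p′} x≼p′ p′<p =
    -- Three errors `½^ (2 + m)` arise, one from the bound and two from `_<ᴿ_`, and four of them fit
    -- into the gap.
    let m , gap = ½^-gap p′<p in *<* (2 ℕ.+ m)
    (<-by-difference (+-mono-<-≤ gap (+-mono-≤ (bound x≼p′ (2 ℕ.+ m))
        (+-mono-≤ (½^-nonNeg (2 ℕ.+ m)) (≤-reflexive (½^-quarter m)))))
      (solve 5 (λ s p p′ h w → ((p′ :+ w) :+ (s :+ (con 0ℚ :+ ((h :+ h) :+ (h :+ h))))) :+ p :=
                               (p :+ ((p′ :+ h) :+ (h :+ w))) :+ (s :+ (h :+ h)))
        refl (seq x (2 ℕ.+ m)) p p′ (½^ (2 ℕ.+ m)) (½^ m)))

  ≺-≤ : ∀ {x p p′} → x ≺ p → p ℚ.≤ p′ → x ≺ p′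
  ≺-≤ (*<* n lt) p≤p′ = *<* n (ℚₚ.<-≤-trans lt p≤p′)

  ≺-open : ∀ {x p} → x ≺ p → ∃[ m ] x ≺ p ℚ.- ½^ m
  ≺-open {x} {p} x≺p =
    let p′ , p′<p , x≼p′ = ≺⇒≼ x≺p
        m , gap = ½^-gap p′<p in
    m , ≼⇒≺ x≼p′ (<-by-difference gap
    (solve 3 (λ p′ p e → (p′ :+ e) :+ (p :- e) := p :+ p′) refl p′ p (½^ m)))

  ≼-≤ᴿ : ∀ {x y p} → x ≤ᴿ y → y ≼ p → x ≼ p
  -- Passing through the finer index `2 + k` costs four errors `½^ (2 + k)`, that is `½^ k`, which
  -- vanishes in the limit.
  ≼-≤ᴿ {x} {y} {p} (*≤* x≤y) y≼p = mk≼ λ n → limit-≤ λ k →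
    ≤-by-difference (+-mono-≤ (regular-≤ x n (2 ℕ.+ k)) (+-mono-≤ (x≤y (2 ℕ.+ k))
        (+-mono-≤ (bound y≼p (2 ℕ.+ k)) (≤-reflexive (½^-quarter k)))))
      (solve 7 (λ s s′ t p e h w →
          (s :+ (s′ :+ (t :+ ((h :+ h) :+ (h :+ h))))) :+ ((p :+ e) :+ w) :=
          ((s′ :+ (e :+ h)) :+ ((t :+ (h :+ h)) :+ ((p :+ h) :+ w))) :+ s)
        refl (seq x n) (seq x (2 ℕ.+ k)) (seq y (2 ℕ.+ k)) p (½^ n) (½^ (2 ℕ.+ k)) (½^ k))

  ≤ᴿ-≺-trans : ∀ {x y p} → x ≤ᴿ y → y ≺ p → x ≺ p
  ≤ᴿ-≺-trans x≤y y≺p = let p′ , p′<p , y≼p′ = ≺⇒≼ y≺p in ≼⇒≺ (≼-≤ᴿ x≤y y≼p′) p′<p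

  ≼-+ : ∀ {x y p p′} → x ≼ p → y ≼ p′ → x +ᴿ y ≼ p ℚ.+ p′
  ≼-+ {x} {y} {p} {p′} x≼p y≼p′ = mk≼ λ n →
    ≤-by-difference (+-mono-≤ (bound x≼p (suc n)) (+-mono-≤ (bound y≼p′ (suc n)) (≤-reflexive (½^-half n))))
      (solve 6 (λ s t p p′ e w → (s :+ (t :+ (e :+ e))) :+ ((p :+ p′) :+ w) :=
                                 ((p :+ e) :+ ((p′ :+ e) :+ w)) :+ (s :+ t))
        refl (seq x (suc n)) (seq y (suc n)) p p′ (½^ suc n) (½^ n))

  ≺-+ : ∀ {x y p p′} → x ≺ p → y ≺ p′ → x +ᴿ y ≺ p ℚ.+ p′
  ≺-+ x≺p y≺p′ =
    let a , a<p , x≼a = ≺⇒≼ x≺p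
        b , b<p′ , y≼b = ≺⇒≼ y≺p′ in
    ≼⇒≺ (≼-+ x≼a y≼b) (ℚₚ.+-mono-< a<p b<p′)

  fromℚ-≼ : ∀ {p} → fromℚ p ≼ p
  fromℚ-≼ {p} = mk≼ λ n → subst (ℚ._≤ p ℚ.+ ½^ n) (ℚₚ.+-identityʳ p) (ℚₚ.+-monoʳ-≤ p (½^-nonNeg n))

  fromℚ-≺ : ∀ {p p′} → fromℚ p ≺ p′ → p ℚ.< p′
  fromℚ-≺ {p} {p′} (*<* n lt) = ℚₚ.≤-<-trans
    (≤-by-difference (+-mono-≤ (½^-nonNeg n) (½^-nonNeg n))
      (solve 2 (λ p e → (con 0ℚ :+ con 0ℚ) :+ (p :+ (e :+ e)) := (e :+ e) :+ p) refl p (½^ n))) lt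

  ≤ᴿ0 : ∀ {x} → (∀ m → x ≺ ½^ m) → x ≤ᴿ 0ᴿ
  ≤ᴿ0 {x} x≺ = *≤* λ n → ℚₚ.≤-trans (limit-≤ λ m → estimate n m (≺⇒≼ (x≺ m)))
    (≤-by-difference (½^-nonNeg n) (solve 1 (λ e → con 0ℚ :+ (con 0ℚ :+ (e :+ e)) := e :+ e) refl (½^ n)))
    where
    estimate : ∀ n m → ∃[ p ] p ℚ.< ½^ m × x ≼ p → seq x n ℚ.≤ ½^ n ℚ.+ ½^ m
    estimate n m (p , p<½ᵐ , x≼p) = ≤-by-difference (+-mono-≤ (bound x≼p n) (ℚₚ.<⇒≤ p<½ᵐ))
      (solve 4 (λ s p e w → (s :+ p) :+ (e :+ w) := ((p :+ e) :+ w) :+ s) refl (seq x n) p (½^ n) (½^ m))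

  ½^-below : ∀ {ε} → 0ᴿ <ᴿ ε → ∃[ m ] (∀ {x} → x ≺ ½^ m → x <ᴿ ε)
  ½^-below {ε} (*<* n lt) = suc n , λ x≺ → below (≺⇒≼ x≺)
    where
    -- Four errors `½^ k` make up `½^ suc n`, exactly the room between the bound on `x` and the
    -- lower bound `½^ n` on `ε`.
    k = 3 ℕ.+ n
    below : ∀ {x} → ∃[ p ] p ℚ.< ½^ suc n × x ≼ p → x <ᴿ ε
    below {x} (p , p< , x≼p) = *<* k
      (<-by-difference (+-mono-<-≤ lt (+-mono-≤ (bound x≼p k) (+-mono-≤ (regular-≤ ε n k)
          (+-mono-≤ (≤-reflexive (½^-quarter (suc n))) (+-mono-≤ (≤-reflexive (½^-half n)) (ℚₚ.<⇒≤ p<))))))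
        (solve 7 (λ s p t t′ e h w →
            ((con 0ℚ :+ (e :+ e)) :+ (s :+ (t :+ (((h :+ h) :+ (h :+ h)) :+ ((w :+ w) :+ p))))) :+ t′ :=
            (t :+ ((p :+ h) :+ ((t′ :+ (e :+ h)) :+ (w :+ (e :+ w))))) :+ (s :+ (h :+ h)))
          refl (seq x k) p (seq ε n) (seq ε k) (½^ n) (½^ k) (½^ suc n)))

  approximation-upper : ∀ {x r p p′} → ∣ x - fromℚ r ∣≤ fromℚ p → r ℚ.+ p ℚ.< p′ → x ≺ p′
  approximation-upper (x≤ , _) = ≼⇒≺ (≼-≤ᴿ x≤ (≼-+ fromℚ-≼ fromℚ-≼))

  approximation-lower : ∀ {x r p p′} → ∣ x - fromℚ r ∣≤ fromℚ p → x ≺ p′ → r ℚ.< p′ ℚ.+ p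
  approximation-lower (_ , r≤) x≺p′ =
    let p″ , p″<p′ , x≼p″ = ≺⇒≼ x≺p′ in
    fromℚ-≺ (≼⇒≺ (≼-≤ᴿ r≤ (≼-+ x≼p″ fromℚ-≼)) (ℚₚ.+-monoˡ-< _ p″<p′))

-- Properties of all sufficiently large numbers

Eventually : ∀ {p} → (ℕ → Set p) → Set p
Eventually P = ∃[ T ] ∀ t → T ℕ.≤ t → P t

module _ {p} {P Q : ℕ → Set p} where

  eventually-map : (∀ t → P t → Q t) → Eventually P → Eventually Q
  eventually-map f (T , h) = T , λ t T≤t → f t (h t T≤t)

  eventually-× : Eventually P → Eventually Q → Eventually λ t → P t × Q t
  eventually-× (T , h) (T′ , h′) = T ℕ.⊔ T′ , λ t T⊔T′≤t →
    h t (ℕₚ.m⊔n≤o⇒m≤o T T′ T⊔T′≤t) , h′ t (ℕₚ.m⊔n≤o⇒n≤o T T′ T⊔T′≤t)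

eventually-∀< : ∀ {p} {P : ℕ → ℕ → Set p} → (∀ k → Eventually (P k)) →
                ∀ b → Eventually λ t → ∀ k → k ℕ.< b → P k t
eventually-∀< ev zero    = 0 , λ _ _ _ ()
eventually-∀< {P = P} ev (suc b) =
  eventually-map (λ t (now , below) k k<1+b → cases t now below k (ℕₚ.m≤n⇒m<n∨m≡n (ℕₚ.≤-pred k<1+b)))
    (eventually-× (ev b) (eventually-∀< ev b))
  where
  cases : ∀ t → P b t → (∀ k → k ℕ.< b → P k t) → ∀ k → k ℕ.< b ⊎ k ≡ b → P k t
  cases t now below k (inj₁ k<b)  = below k k<b
  cases t now below k (inj₂ refl) = now

module _ {x : ℝ} {r : ℕ → ℚ} (approximates : ∀ t → ∣ x - fromℚ (r t) ∣≤ fromℚ (½^ t)) where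
  open +-*-Solver

  -- Completeness of the rational tests: a true strict bound is eventually confirmed with the error
  -- allowed for.
  eventually-below : ∀ {p} → x ≺ p → Eventually λ t → r t ℚ.+ ½^ t ℚ.< p
  eventually-below {p} x≺p =
    let m , x≺p-½ᵐ = ≺-open x≺p in
    -- Two errors `½^ t`, one from the approximation and one from the test, must fit into the slack
    -- `½^ m`.
    suc m , λ t m<t → <-by-difference
      (+-mono-<-≤ (approximation-lower (approximates t) x≺p-½ᵐ)
        (+-mono-≤ (½^-antitone m<t) (+-mono-≤ (½^-antitone m<t) (≤-reflexive (½^-half m)))))
      (solve 5 (λ r p e h w → (r :+ (e :+ (e :+ (h :+ h)))) :+ p :=
                              (((p :- w) :+ e) :+ (h :+ (h :+ w))) :+ (r :+ e))
        refl (r t) p (½^ t) (½^ suc m) (½^ m))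

  -- The failure of `x ≺ p` keeps every approximation plus its error at or above `p`; the gap down
  -- to `p′` then absorbs two errors.
  eventually-above : ∀ {p p′} → ¬ x ≺ p → p′ ℚ.< p → Eventually λ t → p′ ℚ.+ ½^ t ℚ.< r t
  eventually-above {p} {p′} x⊀p p′<p =
    let m , gap = ½^-gap p′<p in
    suc m , λ t m<t → <-by-difference
      (+-mono-<-≤ gap (+-mono-≤ (ℚₚ.≮⇒≥ (x⊀p ∘ approximation-upper (approximates t)))
        (+-mono-≤ (½^-antitone m<t) (+-mono-≤ (½^-antitone m<t) (≤-reflexive (½^-half m))))))
      (solve 6 (λ r p p′ e h w → ((p′ :+ w) :+ (p :+ (e :+ (e :+ (h :+ h))))) :+ r :=
                                 (p :+ ((r :+ e) :+ (h :+ (h :+ w)))) :+ (p′ :+ e))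
        refl (r t) p p′ (½^ t) (½^ suc m) (½^ m))

-- The enumeration

-- r (t ∷ i ∷ j ∷ []) is a rational approximation, up to ½^ t, of the distance of the special
-- points i and j, and R (k ∷ s ∷ t ∷ []) for all t makes s a witness that ball k belongs to the
-- complement.
module Enumeration (r : Vec ℕ 3 → ℚ) (E : BallEnumeration) (R : Vec ℕ 3 → Set) where
  open BallEnumeration E

  Unrefuted : (k s t : ℕ) → Set
  Unrefuted k s t = ∀ t′ → t′ ℕ.< t → R (k ∷ s ∷ t′ ∷ [])

  -- Here and in `Near` the term `½^ t` absorbs the error of `r`, so success at a finite stage
  -- certifies a fact about the true distance: here, that it is at least the radius less `½^ N`.
  Avoids : (k N i t : ℕ) → Set
  Avoids k N i t = ½^ exponent k ℚ.+ ½^ t ℚ.< r (t ∷ centre k ∷ i ∷ []) ℚ.+ ½^ N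

  Near : (n j i t : ℕ) → Set
  Near n j i t = ½^ t ℚ.< r (t ∷ i ∷ j ∷ []) × r (t ∷ i ∷ j ∷ []) ℚ.+ ½^ t ℚ.< ½^ n

  -- The sum `n + j` bounds the pairs tested and fixes the shrinking of the balls. Only finitely
  -- many levels have a sum below a given number.
  Admissible : (n j i t : ℕ) → Set
  Admissible n j i t = Near n j i t ×
    (∀ k → k ℕ.< n ℕ.+ j → ∀ s → s ℕ.< n ℕ.+ j → Unrefuted k s t → Avoids k (n ℕ.+ j) i t)

  -- Minimality of t bounds the indices which level (n , j) contributes.
  Enumerated : (n j t i : ℕ) → Set
  Enumerated n j t i = (i ℕ.< suc t × Admissible n j i t) ×
    (∀ t′ → t′ ℕ.< t → ∀ i′ → i′ ℕ.< suc t′ → ¬ Admissible n j i′ t′)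

  -- Recursiveness of the stage tests

  module _ (r-computable : Computableℚ r) (R-recursive : Recursive R) where

    r-at : ∀ {n} {f g h : Vec ℕ n → ℕ} → Computable f → Computable g → Computable h →
           Computableℚ λ xs → r (f xs ∷ g xs ∷ h xs ∷ [])
    r-at F G H = let (_ , _ , _ , A , B , C , r≡) = r-computable
                     arguments = F ∷ᵛ G ∷ᵛ H ∷ᵛ []ᵛ in
      _ , _ , _ , compose A arguments , compose B arguments , compose C arguments , λ xs → r≡ _

    unrefuted-recursive : Recursive {3} λ xs → Unrefuted (lookup xs 0F) (lookup xs 1F) (lookup xs 2F)
    unrefuted-recursive = bounded-∀
      (substitute {P = R} {h = λ xs → lookup xs 1F ∷ lookup xs 2F ∷ lookup xs 0F ∷ []}
        R-recursive (var 1F ∷ᵛ var 2F ∷ᵛ var 0F ∷ᵛ []ᵛ))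
      (var 2F)

    avoids-recursive : Recursive {4} λ xs → Avoids (lookup xs 0F) (lookup xs 1F) (lookup xs 2F) (lookup xs 3F)
    avoids-recursive =
      (½^ᶠ (compose₁ exponent-computable (var 0F)) +ʳ ½^ᶠ (var 3F)) <ʳ
      (r-at (var 3F) (compose₁ centre-computable (var 0F)) (var 2F) +ʳ ½^ᶠ (var 1F))

    near-recursive : Recursive {4} λ xs → Near (lookup xs 0F) (lookup xs 1F) (lookup xs 2F) (lookup xs 3F)
    near-recursive =
      (½^ᶠ (var 3F) <ʳ r-at (var 3F) (var 2F) (var 1F)) ∧ʳ
      ((r-at (var 3F) (var 2F) (var 1F) +ʳ ½^ᶠ (var 3F)) <ʳ ½^ᶠ (var 0F))

    admissible-recursive : Recursive {4} λ xs → Admissible (lookup xs 0F) (lookup xs 1F) (lookup xs 2F) (lookup xs 3F)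
    admissible-recursive = near-recursive ∧ʳ
      bounded-∀ {P = λ xs → ∀ s → s ℕ.< lookup xs 1F ℕ.+ lookup xs 2F →
                            Unrefuted (lookup xs 0F) s (lookup xs 4F) →
                            Avoids (lookup xs 0F) (lookup xs 1F ℕ.+ lookup xs 2F) (lookup xs 3F) (lookup xs 4F)}
        (bounded-∀
          -- Under both quantifiers the variables are `s`, `k`, `n`, `j`, `i`, `t`, in this order.
          (substitute unrefuted-recursive (var 1F ∷ᵛ var 0F ∷ᵛ var 5F ∷ᵛ []ᵛ) ⇒ʳ
           substitute avoids-recursive (var 1F ∷ᵛ (var 2F +ᶠ var 3F) ∷ᵛ var 4F ∷ᵛ var 5F ∷ᵛ []ᵛ))
          (var 1F +ᶠ var 2F))
        (var 0F +ᶠ var 1F)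

    enumerated-recursive : Recursive {4} λ xs → Enumerated (lookup xs 0F) (lookup xs 1F) (lookup xs 2F) (lookup xs 3F)
    enumerated-recursive =
      (<-recursive (var 3F) (sucᶠ (var 2F)) ∧ʳ
       substitute admissible-recursive (var 0F ∷ᵛ var 1F ∷ᵛ var 3F ∷ᵛ var 2F ∷ᵛ []ᵛ)) ∧ʳ
      bounded-∀ {P = λ xs → ∀ i′ → i′ ℕ.< suc (lookup xs 0F) →
                            ¬ Admissible (lookup xs 1F) (lookup xs 2F) i′ (lookup xs 0F)}
        (bounded-∀
          -- The variables are now `i′`, `t′`, `n`, `j`, `t`, `i`.
          (¬ʳ substitute admissible-recursive (var 2F ∷ᵛ var 3F ∷ᵛ var 0F ∷ᵛ var 1F ∷ᵛ []ᵛ))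
          (sucᶠ (var 0F)))
        (var 2F)

    enumerated-CE : CE λ i → ∃[ n ] ∃[ j ] ∃[ t ] Enumerated n j t i
    enumerated-CE = ∃₃-CE enumerated-recursive

-- Distances and density in a perfect space

lower-excludedMiddle : ∀ {p} q → ExcludedMiddle (p ⊔ q) → ExcludedMiddle p
lower-excludedMiddle q em {P} = map′ lower lift (em {Lift q P})

module Distances {a ℓ} (X : ComputableMetricSpace a ℓ) (emℓ : ExcludedMiddle ℓ) where
  open ComputableMetricSpace X
  open IsGeneralMetric isMetric using (triangle; ≈⇒0; 0⇒≈; nonNegative; ≈-isEquivalence) renaming (sym to d-sym)
  private module ≈ = IsEquivalence ≈-isEquivalence
  open +-*-Solver

  private
    em₀ : ExcludedMiddle 0ℓ
    em₀ = lower-excludedMiddle ℓ emℓ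

  ≺-sym : ∀ {x y p} → d x y ≺ p → d y x ≺ p
  ≺-sym {x} {y} = ≤ᴿ-≺-trans (proj₁ (d-sym y x))

  ≺-triangle : ∀ {x y z p p′} → d x y ≺ p → d y z ≺ p′ → d x z ≺ p ℚ.+ p′
  ≺-triangle {x} {y} {z} x~y y~z = ≤ᴿ-≺-trans (triangle x y z) (≺-+ x~y y~z)

  ≈⇒≺ : ∀ {x y} → x ≈ y → ∀ m → d x y ≺ ½^ m
  ≈⇒≺ x≈y m = ≤ᴿ-≺-trans (proj₁ (≈⇒0 x≈y)) (≼⇒≺ fromℚ-≼ (½^-positive m))

  ≺⇒≈ : ∀ {x y} → (∀ m → d x y ≺ ½^ m) → x ≈ y
  ≺⇒≈ x~y = 0⇒≈ (≤ᴿ0 x~y , nonNegative)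

  -- Classically, if no dyadic bound failed, the distance would be 0.
  ≉⇒⊀ : ∀ {x y} → ¬ x ≈ y → ∃[ m ] ¬ d x y ≺ ½^ m
  ≉⇒⊀ {x} {y} x≉y with em₀ {∃[ m ] ¬ d x y ≺ ½^ m}
  ... | yes apart = apart
  ... | no ¬apart = contradiction
    (≺⇒≈ λ m → decidable-stable em₀ λ x⊀y → ¬apart (m , x⊀y)) x≉y

  ≺-refine : ∀ {x y m n} → m ℕ.≤ n → d x y ≺ ½^ n → d x y ≺ ½^ m
  ≺-refine m≤n x~y = ≺-≤ x~y (½^-antitone m≤n)

  ≈-≺ : ∀ {x y z p} → d x y ≺ p → y ≈ z → d x z ≺ p
  ≈-≺ {x} {y} {z} {p} x~y y≈z =
    let m , gap = ≺-open x~y in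
    subst (d x z ≺_) (p-r+r≡p p (½^ m)) (≺-triangle gap (≈⇒≺ y≈z m))

  dense : ∀ x m → ∃[ i ] d x (q i) ≺ ½^ m
  dense x m = q-dense x (fromℚ (½^ m)) (≼⇒≺ fromℚ-≼ (½^-positive m))

  -- Otherwise every special point of the ball is q j, hence so is every point by density,
  -- and x is isolated.
  dense-apart : Perfect X → ∀ x m j → ∃[ i ] d x (q i) ≺ ½^ m × ¬ q i ≈ q j
  dense-apart perfect x m j with emℓ {∃[ i ] d x (q i) ≺ ½^ m × ¬ q i ≈ q j}
  ... | yes found = found
  ... | no ¬found = contradiction
    (fromℚ (½^ m) , ≼⇒≺ fromℚ-≼ (½^-positive m) , λ y x~y →
      ≈.trans (only-qj x~y) (≈.sym (only-qj (≈⇒≺ ≈.refl m))))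
    (perfect x)
    where
    only-qj : ∀ {y} → d x y ≺ ½^ m → y ≈ q j
    only-qj {y} x~y = decidable-stable emℓ λ y≉qj →
      let k , gap = ≺-open x~y
          l , y⊀qj = ≉⇒⊀ y≉qj
          i , y~qi = dense y (k ℕ.⊔ l)
          x~qi = subst (d x (q i) ≺_) (p-r+r≡p (½^ m) (½^ k))
                   (≺-triangle gap (≺-refine (ℕₚ.m≤m⊔n k l) y~qi))
          qi≈qj = decidable-stable emℓ λ qi≉qj → ¬found (i , x~qi , qi≉qj)
      in y⊀qj (≈-≺ (≺-refine (ℕₚ.m≤n⊔m k l) y~qi) qi≈qj)

  -- Limit points of the enumerated set

  module LimitPoints (E : BallEnumeration) (R : Vec ℕ 3 → Set) (r : Vec ℕ 3 → ℚ)
    (approximates : ∀ t i j → ∣ d (q i) (q j) - fromℚ (r (t ∷ i ∷ j ∷ [])) ∣≤ fromℚ (½^ t)) where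
    open BallEnumeration E
    open Enumeration r E R

    near⇒≺ : ∀ {n j i t} → Near n j i t → d (q i) (q j) ≺ ½^ n
    near⇒≺ {n} {j} {i} {t} (_ , below) = approximation-upper (approximates t i j) below

    near⇒≉ : ∀ {n j i t} → Near n j i t → ¬ q i ≈ q j
    near⇒≉ {n} {j} {i} {t} (above , _) qi≈qj =
      let m , gap = ½^-gap above in
      ℚₚ.<-asym gap (subst (r (t ∷ i ∷ j ∷ []) ℚ.<_) (ℚₚ.+-comm (½^ m) (½^ t))
        (approximation-lower (approximates t i j) (≈⇒≺ qi≈qj m)))

    eventually-near : ∀ {n j i} → d (q i) (q j) ≺ ½^ n → ¬ q i ≈ q j → Eventually (Near n j i)
    eventually-near {n} {j} {i} qi~qj qi≉qj =
      let m , qi⊀qj = ≉⇒⊀ qi≉qj in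
      eventually-×
        (eventually-map (λ t → subst (ℚ._< r (t ∷ i ∷ j ∷ [])) (ℚₚ.+-identityˡ (½^ t)))
          (eventually-above (λ t → approximates t i j) qi⊀qj (½^-positive m)))
        (eventually-below (λ t → approximates t i j) qi~qj)

    -- Were `q i` closer to the centre than the radius less `½^ suc N`, then `x` would be in the
    -- ball. The test asks only for the radius less `½^ N`, and the difference is the room that
    -- `eventually-above` needs.
    eventually-avoids : ∀ {x k N i} → ¬ d (q (centre k)) x ≺ ½^ exponent k →
                        d x (q i) ≺ ½^ suc N → Eventually (Avoids k N i)
    eventually-avoids {x} {k} {N} {i} outside x~qi =
      eventually-map
        (λ t lt → <-by-difference lt
          (solve 4 (λ b e r w → ((b :- w) :+ e) :+ (r :+ w) := r :+ (b :+ e))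
            refl b (½^ t) (r (t ∷ centre k ∷ i ∷ [])) (½^ N)))
        (eventually-above (λ t → approximates t (centre k) i) {b ℚ.- ½^ suc N} {b ℚ.- ½^ N}
          (λ c~qi → outside (subst (d (q (centre k)) x ≺_)
            (p-r+r≡p b (½^ suc N))
            (≺-triangle c~qi (≺-sym x~qi))))
          (<-by-difference (½^-strict N)
            (solve 3 (λ b h w → h :+ (b :- h) := w :+ (b :- w)) refl b (½^ suc N) (½^ N))))
      where b = ½^ exponent k

    Witness : (k s : ℕ) → Set
    Witness k s = ∀ t → R (k ∷ s ∷ t ∷ [])

    eventually-admissible : ∀ {x n j} →
      (∀ k s → Witness k s → ¬ d (q (centre k)) x ≺ ½^ exponent k) → Perfect X →
      d x (q j) ≺ ½^ n → ∃[ i ] Eventually (Admissible n j i)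
    eventually-admissible {x} {n} {j} outside perfect x~qj =
      let m , gap = ≺-open x~qj
          -- Precision `m` keeps `q i` within `½^ n` of `q j`, and `suc N` is what
          -- `eventually-avoids` requires.
          i , x~qi , qi≉qj = dense-apart perfect x (m ℕ.⊔ suc N) j
          qi~qj = subst (d (q i) (q j) ≺_) (solve 2 (λ p e → e :+ (p :- e) := p) refl (½^ n) (½^ m))
                    (≺-triangle (≺-sym (≺-refine (ℕₚ.m≤m⊔n m (suc N)) x~qi)) gap)
      in i , eventually-× (eventually-near {n = n} qi~qj qi≉qj)
        (eventually-∀< (λ k → eventually-∀< (λ s → ball k s (≺-refine (ℕₚ.m≤n⊔m m (suc N)) x~qi)) N) N)
      where
      N = n ℕ.+ j
      ball : ∀ k s {i} → d x (q i) ≺ ½^ suc N → Eventually λ t → Unrefuted k s t → Avoids k N i t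
      -- A refuted pair imposes no condition after its refutation; an unrefuted one is a witness, so
      -- `x` is outside its ball.
      ball k s x~qi with em₀ {∃[ t ] ¬ R (k ∷ s ∷ t ∷ [])}
      ... | yes (t , ¬Rt) = suc t , λ t′ t<t′ unrefuted → contradiction (unrefuted t t<t′) ¬Rt
      ... | no ¬refuted   = eventually-map (λ _ avoids _ → avoids)
        (eventually-avoids {N = N} (outside k s λ t → decidable-stable em₀ λ ¬Rt → ¬refuted (t , ¬Rt)) x~qi)

    enumerate : ∀ {n j i} → Eventually (Admissible n j i) → ∃[ t ] ∃[ i′ ] Enumerated n j t i′
    enumerate {n} {j} {i} (T , admissible) =
      -- Stage `T ⊔ i` is late enough for admissibility and for the search range to include `i`.
      let t , (i′ , here) , minimal = least (λ _ → em₀ {∃[ i ] (i ℕ.< suc _ × Admissible n j i _)}) (T ℕ.⊔ i)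
            (i , s≤s (ℕₚ.m≤n⊔m T i) , admissible (T ℕ.⊔ i) (ℕₚ.m≤m⊔n T i))
      in t , i′ , here , λ t′ t′<t i″ i″≤t′ adm → minimal t′ t′<t (i″ , i″≤t′ , adm)

    enumerated-unique-stage : ∀ {n j t t′ i i′} → Enumerated n j t i → Enumerated n j t′ i′ → t ≡ t′
    enumerated-unique-stage {t = t} {t′} {i} {i′} ((i≤t , adm) , minimal) ((i′≤t′ , adm′) , minimal′)
      with ℕₚ.<-cmp t t′
    ... | tri≈ _ t≡t′ _ = t≡t′
    ... | tri< t<t′ _ _ = contradiction adm (minimal′ t t<t′ i i≤t)
    ... | tri> _ _ t′<t = contradiction adm′ (minimal t′ t′<t i′ i′≤t′)

    -- A level enumerates points at one stage only, and their indices do not exceed that stage.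
    level-bounded : ∀ n j → Eventually λ b → ∀ t i → Enumerated n j t i → i ℕ.< b
    level-bounded n j with em₀ {∃[ t ] ∃[ i ] Enumerated n j t i}
    ... | yes (t , _ , e) = suc t , λ b t<b t′ i e′ → ℕₚ.≤-trans
      (subst (λ t → i ℕ.< suc t) (enumerated-unique-stage e′ e) (proj₁ (proj₁ e′))) t<b
    ... | no ¬e = 0 , λ b _ t i e → contradiction (t , i , e) ¬e

    D : Pred Carrier ℓ
    D x = ∃[ i ] (∃[ n ] ∃[ j ] ∃[ t ] Enumerated n j t i) × x ≈ q i

    outside⇒limitPoint : ∀ {x} → Perfect X →
      (∀ k s → Witness k s → ¬ d (q (centre k)) x ≺ ½^ exponent k) → LimitPoint X D x
    outside⇒limitPoint {x} perfect outside ε 0<ε =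
      let m , below = ½^-below 0<ε
          j , x~qj , x-special = choose m
          -- At level `suc m` the distances from `x` to `q j` and from `q j` to the new point add up
          -- to less than `½^ m`.
          i₀ , ev = eventually-admissible {n = suc m} outside perfect x~qj
          t , i , e = enumerate ev
          near = proj₁ (proj₂ (proj₁ e))
          x~qi = subst (d x (q i) ≺_) (½^-half m)
                   (≺-triangle x~qj (≺-sym (near⇒≺ {n = suc m} near)))
      in q i , (i , (suc m , j , t , e) , ≈.refl) , below x~qi ,
         -- If the new point were `x`, then `x` would be special and hence equal to `q j`, from
         -- which the new point is apart.
         λ qi≈x → near⇒≉ {n = suc m} near (≈.trans qi≈x (x-special (i , ≈.sym qi≈x)))
      where
      choose : ∀ m → ∃[ j ] d x (q j) ≺ ½^ suc m × (∃[ i ] x ≈ q i → x ≈ q j)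
      choose m with emℓ {∃[ j ] x ≈ q j}
      ... | yes (j , x≈qj) = j , ≈⇒≺ x≈qj (suc m) , const x≈qj
      ... | no ¬special = let j , x~qj = dense x (suc m) in
                          j , x~qj , λ special → contradiction special ¬special

    limitPoint⇒outside : ∀ {x} → LimitPoint X D x →
      ∀ k s → Witness k s → ¬ d (q (centre k)) x ≺ ½^ exponent k
    limitPoint⇒outside {x} limit k s witness c~x =
      let a , gap = ≺-open c~x
          -- Levels from `N` on stay away from `x`; `b` bounds the indices from lower levels, and
          -- `l` separates `x` from those of the finitely many points `q i` with `i < b` that differ
          -- from it.
          N = threshold a
          b , bounded = eventually-∀< (λ n → eventually-∀< (level-bounded n) N) N
          l , apart = eventually-∀< eventually-apart b
          M = suc a ℕ.⊔ l
          y , (i , (n , j , t , e) , y≈qi) , x~y , y≉x =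
            limit (fromℚ (½^ M)) (≼⇒≺ fromℚ-≼ (½^-positive M))
          x~qi = ≈-≺ x~y y≈qi
          n+j<N = low-level a e (≺-refine (ℕₚ.m≤m⊔n (suc a) l) x~qi) gap
          i<b = bounded b ℕₚ.≤-refl n (ℕₚ.≤-<-trans (ℕₚ.m≤m+n n j) n+j<N)
                                    j (ℕₚ.≤-<-trans (ℕₚ.m≤n+m j n) n+j<N) t i e
      in y≉x (≈.trans y≈qi (apart l ℕₚ.≤-refl i i<b (≺-refine (ℕₚ.m≤n⊔m (suc a) l) x~qi)))
      where
      eventually-apart : ∀ i → Eventually λ l → d x (q i) ≺ ½^ l → q i ≈ x
      eventually-apart i with emℓ {x ≈ q i}
      ... | yes x≈qi = 0 , λ _ _ _ → ≈.sym x≈qi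
      ... | no x≉qi  = let m , x⊀qi = ≉⇒⊀ x≉qi in
        m , λ l m≤l x~qi → contradiction (≺-refine m≤l x~qi) x⊀qi
      -- The first entry makes `½^ N` at most half of the slack `½^ a`; the second puts the pair
      -- `(k , s)` among those tested.
      threshold : ℕ → ℕ
      threshold a = suc a ℕ.⊔ suc (k ℕ.⊔ s)
      low-level : ∀ a {n j t i} → Enumerated n j t i → d x (q i) ≺ ½^ suc a →
                  d (q (centre k)) x ≺ ½^ exponent k ℚ.- ½^ a → n ℕ.+ j ℕ.< threshold a
      low-level a {n} {j} {t} {i} ((_ , _ , avoids) , _) x~qi gap = ℕₚ.≰⇒> λ high →
        let k⊔s<n+j = ℕₚ.≤-trans (ℕₚ.m≤n⊔m (suc a) (suc (k ℕ.⊔ s))) high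
            avoided = avoids k (ℕₚ.≤-<-trans (ℕₚ.m≤m⊔n k s) k⊔s<n+j)
                             s (ℕₚ.≤-<-trans (ℕₚ.m≤n⊔m k s) k⊔s<n+j) (λ t′ _ → witness t′)
        -- By the triangle inequality the point is within the radius less `½^ suc a` of the centre,
        -- too deep in the ball to have passed the test.
        in ℚₚ.<-irrefl refl (<-by-difference {0ℚ} {0ℚ}
          (+-mono-<-≤ avoided (+-mono-≤
            (ℚₚ.<⇒≤ (approximation-lower (approximates t (centre k) i) (≺-triangle gap x~qi)))
            (+-mono-≤ (½^-antitone (ℕₚ.≤-trans (ℕₚ.m≤m⊔n (suc a) (suc (k ℕ.⊔ s))) high))
              (≤-reflexive (½^-half a)))))
          (solve 6 (λ b e r u h w →
              ((b :+ e) :+ (r :+ (u :+ (h :+ h)))) :+ con 0ℚ :=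
              ((r :+ u) :+ ((((b :- w) :+ h) :+ e) :+ (h :+ w))) :+ con 0ℚ)
            refl (½^ exponent k) (½^ t) (r (t ∷ centre k ∷ i ∷ [])) (½^ (n ℕ.+ j)) (½^ suc a) (½^ a)))

-- Membership in `C` read off from the presentation of its complement

mainTheorem16 : ∀ {a ℓ c : Level} → ExcludedMiddle (a ⊔ ℓ ⊔ c) →
    (X : ComputableMetricSpace a ℓ) → Perfect X →
    (E : BallEnumeration) →
    (C : Pred (ComputableMetricSpace.Carrier X) c) → Π⁰₁[∅′] X E C →
    Σ (Pred (ComputableMetricSpace.Carrier X) ℓ) λ D →
    CESpecial X D × (∀ x → x ∈ C ⇔ LimitPoint X D x)
mainTheorem16 {a} {ℓ} {c} em X perfect E C (I , (R , R-computable , I⇔) , ∉C⇔) =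
  D ,
  (_ , Enumeration.enumerated-CE r E R r-computable (fromComputablePred R-computable) , λ x → mk⇔ id id) ,
  λ x → mk⇔
    (λ x∈C → outside⇒limitPoint perfect λ k s witness inside →
      from (∉C⇔ x) (k , from (I⇔ k) (s , witness) , inside) x∈C)
    -- The presentation describes only non-membership, so membership is obtained by double negation.
    (λ limit → decidable-stable emᶜ λ x∉C →
      let k , k∈I , inside = to (∉C⇔ x) x∉C
          s , witness = to (I⇔ k) k∈I
      in limitPoint⇒outside limit k s witness inside)
  where
  open ComputableMetricSpace X using (d; q; d-computable)
  emℓ : ExcludedMiddle ℓ
  emℓ = lower-excludedMiddle (a ⊔ c) em
  emᶜ : ExcludedMiddle c
  emᶜ = lower-excludedMiddle (a ⊔ ℓ) em
  r : Vec ℕ 3 → ℚ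
  r = proj₁ d-computable
  r-computable : Computableℚ r
  r-computable = proj₁ (proj₂ d-computable)
  approximates : ∀ t i j → ∣ d (q i) (q j) - fromℚ (r (t ∷ i ∷ j ∷ [])) ∣≤ fromℚ (½^ t)
  approximates t i j = proj₂ (proj₂ d-computable) t (i ∷ j ∷ [])
  open Distances.LimitPoints X emℓ E R r approximates
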